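{- For a rational number $n$, let $X\subset\mathbb{P}^4_{\mathbb{Q}}$ be the intersection of two quadrics given in affine coordinates $(x,y,u,v)$ by $$xy+x+y-n=u^2,\qquad xy-x-y+n=v^2.$$ For generic $n$ (that is, for all but finitely many rational $n$) the following hold. (1) $X$ is smooth, hence a del Pezzo surface of degree $4$ over $\mathbb{Q}$. (2) Let $\pi\colon X\dashrightarrow\mathbb{P}^1$ be the conic fibration $(x,y,u,v)\mapsto y$, and let $\pi'\colon X'\dashrightarrow\mathbb{P}^1$ be the base-change of $\pi$ along the map $\phi\colon\mathbb{P}^1\to\mathbb{P}^1$, $t\mapsto\dfrac{t^2+1}{t^2-1}$. Then $X'$ is geometrically integral, $\pi'$ has a section over $\mathbb{Q}$, and $X'$ is birational to $\mathbb{P}^2$ over $\mathbb{Q}$. Since $X'$ dominates $X$, there is consequently a dominant rational map $\mathbb{P}^2\dashrightarrow X$ over $\mathbb{Q}$.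
   Context: In homogeneous coordinates $(x:y:u:v:z)$ on $\mathbb{P}^4$, the surface $X$ is given by $xy+xz+yz-nz^2=u^2$, $xy-xz-yz+nz^2=v^2$. Up to birational equivalence, $X'$ is the surface in $(x,t,u,v)$-space obtained by substituting $y=\frac{t^2+1}{t^2-1}$ into the affine equations of $X$, with $\pi'$ the projection to $t$. A section of $\pi'$ is a rational map $\sigma\colon\mathbb{P}^1\dashrightarrow X'$ with $\pi'\circ\sigma=\mathrm{id}$. -}

module Defs where

open import Algebra.Bundles using (CommutativeRing; RawRing)
open import Algebra.Morphism.Structures using (module RingMorphisms)
import Algebra.Properties.Monoid.Sum as Sum
open import Data.Bool.Base using (if_then_else_)
open import Data.Fin.Base using (Fin; zero; suc; inject)
open import Data.Fin.Properties using (_≟_)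
open import Data.Nat.Base using (ℕ; zero; suc) renaming (_+_ to _+ℕ_)
open import Data.Product.Base using (Σ-syntax; ∃-syntax; _×_; _,_)
open import Data.Rational.Base using (ℚ; 0ℚ; 1ℚ)
open import Data.Rational.Properties using () renaming (+-*-commutativeRing to ℚ-ring)
open import Data.Sum.Base using (_⊎_)
open import Data.Vec.Functional using (Vector; []; _∷_)
open import Function.Base using (_∘_)
open import Level using (0ℓ) renaming (suc to lsuc)
open import Relation.Binary.Definitions using (Decidable)
open import Relation.Binary.PropositionalEquality.Core using (_≡_)
open import Relation.Nullary.Decidable.Core using (does)
open import Relation.Nullary.Negation using (¬_)

------------------------------------------------------------------------
-- Polynomials

-- Polynomial expressions.  They are only ever compared by the congruence
-- _⊢_≈_ below, never by _≡_.

infixl 6 _⊕_ _⊖_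
infixl 7 _⊗_
infix  8 ⊝_

data Poly (A : Set) (n : ℕ) : Set where
  con     : A → Poly A n
  var     : Fin n → Poly A n
  _⊕_ _⊗_ : Poly A n → Poly A n → Poly A n
  ⊝_      : Poly A n → Poly A n

_⊖_ : ∀ {A n} → Poly A n → Poly A n → Poly A n
p ⊖ q = p ⊕ ⊝ q

module _ {A : Set} (R : RawRing 0ℓ 0ℓ) (h : A → RawRing.Carrier R) where
  open RawRing R

  eval : ∀ {n} → Vector Carrier n → Poly A n → Carrier
  eval ρ (con a) = h a
  eval ρ (var i) = ρ i
  eval ρ (p ⊕ q) = eval ρ p + eval ρ q
  eval ρ (p ⊗ q) = eval ρ p * eval ρ q
  eval ρ (⊝ p)   = - eval ρ p

polyRawRing : RawRing 0ℓ 0ℓ → ℕ → RawRing 0ℓ 0ℓ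
polyRawRing R n = record
  { Carrier = Poly (RawRing.Carrier R) n
  ; _≈_ = _≡_
  ; _+_ = _⊕_
  ; _*_ = _⊗_
  ; -_  = ⊝_
  ; 0#  = con (RawRing.0# R)
  ; 1#  = con (RawRing.1# R)
  }

subst : ∀ {m n} → Vector (Poly ℚ n) m → Poly ℚ m → Poly ℚ n
subst {n = n} = eval (polyRawRing (CommutativeRing.rawRing ℚ-ring) n) con

∂ : ∀ {n} → Fin n → Poly ℚ n → Poly ℚ n
∂ i (con a) = con 0ℚ
∂ i (var j) = con (if does (i ≟ j) then 1ℚ else 0ℚ)
∂ i (p ⊕ q) = ∂ i p ⊕ ∂ i q
∂ i (p ⊗ q) = ∂ i p ⊗ q ⊕ p ⊗ ∂ i q
∂ i (⊝ p)   = ⊝ ∂ i p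

module _ (k : CommutativeRing 0ℓ 0ℓ) where
  private module k = CommutativeRing k

  -- E ⊢ p ≈ q : the polynomials p and q over k are congruent modulo the
  -- ideal generated by the E i.  This is the least congruence making the
  -- expressions a commutative k-algebra in which every E i vanishes; for
  -- E = [] it is equality of polynomials.

  infix 4 _⊢_≈_

  data _⊢_≈_ {n c} (E : Vector (Poly k.Carrier n) c) :
             Poly k.Carrier n → Poly k.Carrier n → Set where
    ≈-refl  : ∀ {p} → E ⊢ p ≈ p
    ≈-sym   : ∀ {p q} → E ⊢ p ≈ q → E ⊢ q ≈ p
    ≈-trans : ∀ {p q r} → E ⊢ p ≈ q → E ⊢ q ≈ r → E ⊢ p ≈ r

    ⊕-cong : ∀ {p p′ q q′} → E ⊢ p ≈ p′ → E ⊢ q ≈ q′ → E ⊢ p ⊕ q ≈ p′ ⊕ q′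
    ⊗-cong : ∀ {p p′ q q′} → E ⊢ p ≈ p′ → E ⊢ q ≈ q′ → E ⊢ p ⊗ q ≈ p′ ⊗ q′
    ⊝-cong : ∀ {p p′} → E ⊢ p ≈ p′ → E ⊢ ⊝ p ≈ ⊝ p′

    ⊕-assoc     : ∀ p q r → E ⊢ (p ⊕ q) ⊕ r ≈ p ⊕ (q ⊕ r)
    ⊕-comm      : ∀ p q → E ⊢ p ⊕ q ≈ q ⊕ p
    ⊕-identityˡ : ∀ p → E ⊢ con k.0# ⊕ p ≈ p
    ⊝-inverseˡ  : ∀ p → E ⊢ ⊝ p ⊕ p ≈ con k.0#
    ⊗-assoc     : ∀ p q r → E ⊢ (p ⊗ q) ⊗ r ≈ p ⊗ (q ⊗ r)
    ⊗-comm      : ∀ p q → E ⊢ p ⊗ q ≈ q ⊗ p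
    ⊗-identityˡ : ∀ p → E ⊢ con k.1# ⊗ p ≈ p
    ⊗-distribˡ  : ∀ p q r → E ⊢ p ⊗ (q ⊕ r) ≈ p ⊗ q ⊕ p ⊗ r

    con-cong : ∀ {a b} → a k.≈ b → E ⊢ con a ≈ con b
    con-+    : ∀ a b → E ⊢ con (a k.+ b) ≈ con a ⊕ con b
    con-*    : ∀ a b → E ⊢ con (a k.* b) ≈ con a ⊗ con b

    relation : ∀ i → E ⊢ E i ≈ con k.0#

  quotientRing : ∀ {n c} → Vector (Poly k.Carrier n) c → CommutativeRing 0ℓ 0ℓ
  quotientRing E = record
    { Carrier = Poly k.Carrier _
    ; _≈_ = E ⊢_≈_
    ; _+_ = _⊕_
    ; _*_ = _⊗_
    ; -_ = ⊝_
    ; 0# = con k.0#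
    ; 1# = con k.1#
    ; isCommutativeRing = record
      { isRing = record
        { +-isAbelianGroup = record
          { isGroup = record
            { isMonoid = record
              { isSemigroup = record
                { isMagma = record
                  { isEquivalence = record
                    { refl = ≈-refl ; sym = ≈-sym ; trans = ≈-trans }
                  ; ∙-cong = ⊕-cong
                  }
                ; assoc = ⊕-assoc
                }
              ; identity = ⊕-identityˡ
                         , λ p → ≈-trans (⊕-comm _ _) (⊕-identityˡ p)
              }
            ; inverse = ⊝-inverseˡ
                      , λ p → ≈-trans (⊕-comm _ _) (⊝-inverseˡ p)
            ; ⁻¹-cong = ⊝-cong
            }
          ; comm = ⊕-comm
          }
        ; *-cong = ⊗-cong
        ; *-assoc = ⊗-assoc
        ; *-identity = ⊗-identityˡ
                     , λ p → ≈-trans (⊗-comm _ _) (⊗-identityˡ p)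
        ; distrib = ⊗-distribˡ
                  , λ p q r → ≈-trans (⊗-comm _ _)
                      (≈-trans (⊗-distribˡ p q r)
                               (⊕-cong (⊗-comm _ _) (⊗-comm _ _)))
        }
      ; *-comm = ⊗-comm
      }
    }

IsIntegralDomain : CommutativeRing 0ℓ 0ℓ → Set
IsIntegralDomain R =
  ¬ (1# ≈ 0#) × (∀ x y → x * y ≈ 0# → x ≈ 0# ⊎ y ≈ 0#)
  where open CommutativeRing R

-- Field extensions of ℚ.  Geometric notions are expressed by quantifying
-- over all of them; level zero contains the algebraic closure of ℚ.  Equality
-- is decidable, as it is classically.

record Extension : Set (lsuc 0ℓ) where
  field
    commutativeRing : CommutativeRing 0ℓ 0ℓ
  open CommutativeRing commutativeRing public
  field
    _≈?_       : Decidable _≈_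
    1≉0        : ¬ (1# ≈ 0#)
    invertible : ∀ x → ¬ (x ≈ 0#) → ∃[ y ] y * x ≈ 1#
    ι          : ℚ → Carrier
    ι-homo     : RingMorphisms.IsRingHomomorphism
                   (CommutativeRing.rawRing ℚ-ring) rawRing ι

------------------------------------------------------------------------
-- Affine schemes of finite type over ℚ, as closed subschemes of 𝔸ⁿ

record Affine : Set where
  field
    {dim}     : ℕ
    {count}   : ℕ
    equations : Vector (Poly ℚ dim) count

  Fn : Set
  Fn = Poly ℚ dim

  coordinateRing : CommutativeRing 0ℓ 0ℓ
  coordinateRing = quotientRing ℚ-ring equations

  coordinateRing⊗ : Extension → CommutativeRing 0ℓ 0ℓ
  coordinateRing⊗ K = quotientRing K.commutativeRing (baseChange ∘ equations)
    where
    module K = Extension K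
    baseChange : Poly ℚ dim → Poly K.Carrier dim
    baseChange = eval (polyRawRing K.rawRing dim) (con ∘ K.ι) var

open Affine public using (Fn; coordinateRing; coordinateRing⊗)

infix 4 _∋_≈_

_∋_≈_ : (X : Affine) → Fn X → Fn X → Set
X ∋ f ≈ g = CommutativeRing._≈_ (coordinateRing X) f g

GeometricallyIntegral : Affine → Set₁
GeometricallyIntegral X = ∀ (K : Extension) → IsIntegralDomain (coordinateRing⊗ X K)

record Morphism (X Y : Affine) : Set where
  field
    component : Vector (Fn X) (Affine.dim Y)

  pullback : Fn Y → Fn X
  pullback = subst component

  field
    satisfies : ∀ i → X ∋ pullback (Affine.equations Y i) ≈ con 0ℚ

open Morphism public using (component; pullback)

-- Injectivity on functions.  It implies that the image is dense, and is
-- equivalent to it when Y is reduced.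
Dominant : ∀ {X Y} → Morphism X Y → Set
Dominant {X} {Y} f = ∀ g → X ∋ pullback f g ≈ con 0ℚ → Y ∋ g ≈ con 0ℚ

record Isomorphism (X Y : Affine) : Set where
  field
    to      : Morphism X Y
    from    : Morphism Y X
    from∘to : ∀ i → X ∋ pullback to (component from i) ≈ var i
    to∘from : ∀ j → Y ∋ pullback from (component to j) ≈ var j

weaken : ∀ {n} → Poly ℚ n → Poly ℚ (suc n)
weaken = subst (var ∘ suc)

-- The locus d ≠ 0 in X; the new variable, numbered zero, is 1 / d.
basicOpen : (X : Affine) → Fn X → Affine
basicOpen X d = record
  { equations = (var zero ⊗ weaken d ⊖ con 1ℚ) ∷ (weaken ∘ Affine.equations X) }

-- For X integral, the basic opens of nonzero functions are nonempty, hence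
-- dense, and every nonempty open subset contains one of them.  The next two
-- notions are only used for X (and, in Birational, Y) integral.

record RationalMap (X Y : Affine) : Set where
  field
    denominator   : Fn X
    denominator≉0 : ¬ (X ∋ denominator ≈ con 0ℚ)
    morphism      : Morphism (basicOpen X denominator) Y

open RationalMap public using (denominator; morphism)

Birational : Affine → Affine → Set
Birational X Y =
  Σ[ d ∈ Fn X ] Σ[ e ∈ Fn Y ]
    ¬ (X ∋ d ≈ con 0ℚ) × ¬ (Y ∋ e ≈ con 0ℚ) ×
    Isomorphism (basicOpen X d) (basicOpen Y e)

------------------------------------------------------------------------
-- Closed subschemes of ℙᴺ over ℚ

data Homogeneous {n} : ℕ → Poly ℚ n → Set where
  con  : ∀ a → Homogeneous 0 (con a)
  var  : ∀ i → Homogeneous 1 (var i)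
  zero : ∀ d → Homogeneous d (con 0ℚ)
  _⊕_  : ∀ {d p q} → Homogeneous d p → Homogeneous d q → Homogeneous d (p ⊕ q)
  ⊝_   : ∀ {d p} → Homogeneous d p → Homogeneous d (⊝ p)
  _⊗_  : ∀ {d e p q} → Homogeneous d p → Homogeneous e q →
         Homogeneous (d +ℕ e) (p ⊗ q)
  resp : ∀ {d p q} → _⊢_≈_ ℚ-ring [] p q → Homogeneous d p → Homogeneous d q

record Projective (N c : ℕ) : Set where
  field
    form        : Vector (Poly ℚ (suc N)) c
    degree      : Vector ℕ c
    homogeneous : ∀ i → Homogeneous (degree i) (form i)

ℙ : ∀ N → Projective N 0
ℙ N = record { form = [] ; degree = [] ; homogeneous = λ () }

-- The affine chart where the coordinate numbered zero equals 1.  For ℙᴺ and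
-- for the surface X below it is dense, so that rational maps from or to these
-- schemes may be given on their charts.
chart : ∀ {N c} → Projective N c → Affine
chart X = record { equations = subst (con 1ℚ ∷ var) ∘ Projective.form X }

-- The forms are a regular sequence: each is a non-zero-divisor modulo the
-- preceding ones.
CompleteIntersection : ∀ {N c} → Projective N c → Set
CompleteIntersection X =
  ∀ i g → _⊢_≈_ ℚ-ring (form ∘ inject {i = i}) (form i ⊗ g) (con 0ℚ) →
          _⊢_≈_ ℚ-ring (form ∘ inject {i = i}) g (con 0ℚ)
  where open Projective X

-- Jacobian criterion for smoothness of dimension N - c: at every geometric
-- point the Jacobian matrix of the c forms has rank c, that is, its rows are
-- linearly independent.
Smooth : ∀ {N c} → Projective N c → Set₁
Smooth {N} {c} X =
  ∀ (K : Extension) → let open Extension K in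
  (P : Vector Carrier (suc N)) → (∃[ j ] ¬ (P j ≈ 0#)) →
  (∀ i → eval rawRing ι P (form i) ≈ 0#) →
  (a : Vector Carrier c) →
  (∀ j → Sum.sum +-monoid (λ i → a i * eval rawRing ι P (∂ j (form i))) ≈ 0#) →
  ∀ i → a i ≈ 0#
  where open Projective X

-- A del Pezzo surface of degree 4, in its anticanonical embedding, is a
-- smooth complete intersection of two quadrics in ℙ⁴.
record IsDelPezzo₄ (X : Projective 4 2) : Set₁ where
  field
    quadrics             : ∀ i → Projective.degree X i ≡ 2
    completeIntersection : CompleteIntersection X
    smooth               : Smooth X

------------------------------------------------------------------------
-- The surface X, its conic fibration, and the base change X′

-- Homogeneous coordinates (z : x : y : u : v), so that chart (X n) has the
-- coordinates (x, y, u, v):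
--   x y + x z + y z - n z² = u²,   x y - x z - y z + n z² = v².
X : ℚ → Projective 4 2
X n = record
  { form = (x ⊗ y ⊕ x ⊗ z ⊕ y ⊗ z ⊖ con n ⊗ (z ⊗ z) ⊖ u ⊗ u)
         ∷ (x ⊗ y ⊖ x ⊗ z ⊖ y ⊗ z ⊕ con n ⊗ (z ⊗ z) ⊖ v ⊗ v) ∷ []
  ; degree = λ _ → 2
  ; homogeneous = λ where
      zero → var _ ⊗ var _ ⊕ var _ ⊗ var _ ⊕ var _ ⊗ var _
           ⊕ ⊝ (con n ⊗ (var _ ⊗ var _)) ⊕ ⊝ (var _ ⊗ var _)
      (suc zero) → var _ ⊗ var _ ⊕ ⊝ (var _ ⊗ var _) ⊕ ⊝ (var _ ⊗ var _)
           ⊕ con n ⊗ (var _ ⊗ var _) ⊕ ⊝ (var _ ⊗ var _)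
  }
  where
  z x y u v : Poly ℚ 5
  z = var zero
  x = var (suc zero)
  y = var (suc (suc zero))
  u = var (suc (suc (suc zero)))
  v = var (suc (suc (suc (suc zero))))

𝔸¹ : Affine
𝔸¹ = chart (ℙ 1)

π : ∀ n → Morphism (chart (X n)) 𝔸¹
π n = record { component = λ _ → var (suc zero) ; satisfies = λ () }

-- φ(t) = (t² + 1) / (t² - 1), on the locus t² ≠ 1 of 𝔸¹; the coordinates
-- there are w = 1 / (t² - 1) and t.

t²-1 : Fn 𝔸¹
t²-1 = var zero ⊗ var zero ⊖ con 1ℚ

φ : Morphism (basicOpen 𝔸¹ t²-1) 𝔸¹
φ = record { component = λ _ → (t ⊗ t ⊕ con 1ℚ) ⊗ w ; satisfies = λ () }
  where
  w t : Poly ℚ 2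
  w = var zero
  t = var (suc zero)

-- The fibre product of π and φ.  Coordinates (w, t, x, u, v): the equation
-- w (t² - 1) = 1, followed by those of chart (X n) with φ(t) in place of y.

substituteφ : Vector (Poly ℚ 5) 4
substituteφ = x ∷ subst (w ∷ t ∷ []) (component φ zero) ∷ u ∷ v ∷ []
  where
  w t x u v : Poly ℚ 5
  w = var zero
  t = var (suc zero)
  x = var (suc (suc zero))
  u = var (suc (suc (suc zero)))
  v = var (suc (suc (suc (suc zero))))

X′ : ℚ → Affine
X′ n = record
  { equations = (var zero ⊗ subst (λ _ → var (suc zero)) t²-1 ⊖ con 1ℚ)
              ∷ (subst substituteφ ∘ Affine.equations (chart (X n))) }

π′ : ∀ n → Morphism (X′ n) 𝔸¹
π′ n = record { component = λ _ → var (suc zero) ; satisfies = λ () }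

X′→X : ∀ n → Morphism (X′ n) (chart (X n))
X′→X n = record { component = substituteφ ; satisfies = relation ∘ suc }

-- X′ → X lies over φ: the composite π ∘ X′→X is φ(t).
X′→X-over-φ : ∀ n → X′ n ∋ pullback (X′→X n) (component (π n) zero)
                           ≈ subst (var zero ∷ var (suc zero) ∷ []) (component φ zero)
X′→X-over-φ n = ≈-refl

-- σ is a section of p when p ∘ σ is the identity of 𝔸¹, as rational maps.
IsSection : ∀ {Y} → Morphism Y 𝔸¹ → RationalMap 𝔸¹ Y → Set
IsSection p σ =
  basicOpen 𝔸¹ (denominator σ) ∋
    pullback (morphism σ) (component p zero) ≈ weaken (var zero)

module Submission where

-- The surface X′.  Put y = (t² + 1) w with w = 1 / (t² - 1).  Since y - 1 = 2 w is
-- a unit, the second equation of X′ determines x, and the first one becomes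
--   (u + t v) (u - t v) = c,   c = (t² + 1) (y - n).
-- A conic split in this way is parametrised by p = u + t v: then u - t v = c / p,
-- and X′ is isomorphic to the plane with coordinates (p, t) where t p (t² - 1) and
-- t (u + t v) do not vanish.  This is the birational map, the curve p = 1 is a
-- section, and composition with X′ → X gives the map from the plane to X.
--
-- Integrality and dominance.  Functions on X and on X′ are combinations of
-- 1, u, v and u v with coefficients in (x, y), respectively in (x, t) and w, since
-- u² and v² are such coefficients.  Let f vanish at all parametrised points.
-- Where c is not zero, these are stable under the sign changes of u and v, so each
-- coefficient of f vanishes on their projection to the plane; that is dense, and
-- so f = 0 (X′-vanishing and X-vanishing).  Dominance follows at once.  For
-- integrality over a field K, the pullback of f to the (p, t)-plane is a fraction
-- whose numerator is a polynomial; either that is zero, and then f = 0, or it is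
-- nonzero outside a thin set (zero-or-generically-≉0), so that two
-- such functions have a nonzero product (X′-isIntegralDomain).
--
-- The surface X.  Members of the pencil of quadrics through X are nearly diagonal,
-- and a case distinction shows that a singular point of one of them is not on X
-- when n is not 0, 1 or -1 (X-smooth).  The forms are a regular sequence because
-- the first one is D - u² with D free of u and v, and so the ring it defines is
-- free with basis 1, u over polynomials in z, x, y and v, among which is the second
-- form (X-completeIntersection).

open import Defs
open import Algebra.Bundles using (CommutativeRing; RawRing)
open import Algebra.Morphism.Structures using (module RingMorphisms)
import Algebra.Morphism.Construct.Composition as Composition
import Algebra.Morphism.Construct.Identity as Identity
import Algebra.Properties.Ring as RingProperties
import Algebra.Solver.Ring as RingSolver
open import Algebra.Solver.Ring.AlmostCommutativeRing using
  (fromCommutativeRing; _-Raw-AlmostCommutative⟶_; Induced-equivalence)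
open import Data.Empty using (⊥; ⊥-elim)
open import Data.Fin.Base using (Fin; zero; suc; inject)
open import Data.Fin.Patterns using (0F; 1F; 2F; 3F; 4F; 5F)
open import Data.Integer.Base using (+_)
open import Data.Integer.Properties using (+-injective)
open import Data.List.Base as List using (List; []; _∷_; length; _++_)
open import Data.List.Membership.Propositional using (_∉_)
open import Data.List.Relation.Unary.All using (All; []; _∷_)
open import Data.List.Relation.Unary.All.Properties using (++⁻ˡ; ++⁻ʳ)
open import Data.List.Relation.Unary.Any using (Any; here; there; any?)
import Data.Maybe.Base as Maybe
open import Data.Nat.Base using (ℕ; zero; suc; _≤_; _⊔_)
open import Data.Nat.Properties using (≤-refl; <⇒≢; m⊔n≤o⇒m≤o; m⊔n≤o⇒n≤o; suc-injective)
open import Data.Product.Base using (Σ-syntax; ∃-syntax; _×_; _,_; proj₁; proj₂)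
open import Data.Rational.Base as ℚ using (ℚ; 0ℚ; 1ℚ; ½)
open import Data.Rational.Literals using (fromℤ)
import Data.Rational.Properties as ℚ
open import Data.Rational.Properties using () renaming (+-*-commutativeRing to ℚ-ring; _≟_ to _≟ℚ_)
open import Data.Sum.Base using (_⊎_; inj₁; inj₂)
open import Data.Unit.Base using (⊤; tt)
import Data.Vec.Functional as Vec
open import Data.Vec.Functional using (Vector)
open import Function.Base using (_∘_; id)
open import Level using (0ℓ) renaming (suc to lsuc)
open import Relation.Binary.PropositionalEquality as ≡ using (_≡_; _≢_)
open import Relation.Binary.Definitions using (WeaklyDecidable)
import Relation.Binary.Reasoning.Setoid as SetoidReasoning
open import Relation.Nullary.Decidable using (Dec; yes; no; ¬?; dec⇒maybe)
open import Relation.Nullary.Negation using (¬_; contradiction)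

-- Algebras over ℚ and evaluation of polynomials

-- Ring homomorphisms, as functions between the carriers.
IsHom : (R S : CommutativeRing 0ℓ 0ℓ) →
        (CommutativeRing.Carrier R → CommutativeRing.Carrier S) → Set
IsHom R S = RingMorphisms.IsRingHomomorphism
              (CommutativeRing.rawRing R) (CommutativeRing.rawRing S)

-- A commutative ring under ℚ, the common setting for computations in fields
-- and in rings of polynomials modulo an ideal.
record ℚ-Algebra : Set (lsuc 0ℓ) where
  field
    commutativeRing : CommutativeRing 0ℓ 0ℓ
  open CommutativeRing commutativeRing public hiding (zero)
  field
    ι      : ℚ → Carrier
    ι-homo : IsHom ℚ-ring commutativeRing ι
  open RingMorphisms.IsRingHomomorphism ι-homo public
    using (+-homo; *-homo; -‿homo; 0#-homo; 1#-homo)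
  open RingProperties ring public using (x∙y⁻¹≈ε⇒x≈y; -1*x≈-x; -0#≈0#)

  ι-cong : ∀ {a b} → a ≡ b → ι a ≈ ι b
  ι-cong ≡.refl = refl

  private
    constants : CommutativeRing.rawRing ℚ-ring -Raw-AlmostCommutative⟶ fromCommutativeRing commutativeRing
    constants = record { ⟦_⟧ = ι ; +-homo = +-homo ; *-homo = *-homo ; -‿homo = -‿homo
                       ; 0-homo = 0#-homo ; 1-homo = 1#-homo }

    constants-≟ : WeaklyDecidable (Induced-equivalence constants)
    constants-≟ a b = Maybe.map ι-cong (dec⇒maybe (a ≟ℚ b))

    module Solver = RingSolver (CommutativeRing.rawRing ℚ-ring) (fromCommutativeRing commutativeRing)
                               constants constants-≟
  open Solver using (Polynomial) public

  -- Polynomial expressions for the ring solver, with κ a the constant ι a.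

  infixl 7 _:+_ _:-_
  infixl 8 _:*_
  infix  9 :-_
  infix  4 _:=_

  κ : ∀ {n} → ℚ → Polynomial n
  κ = Solver.con

  _:+_ _:*_ _:-_ : ∀ {n} → Polynomial n → Polynomial n → Polynomial n
  _:+_ = Solver._:+_
  _:*_ = Solver._:*_
  _:-_ = Solver._:-_

  :-_ : ∀ {n} → Polynomial n → Polynomial n
  :-_ = Solver.:-_

  _:=_ : ∀ {n} → Polynomial n → Polynomial n → Polynomial n × Polynomial n
  _:=_ = Solver._:=_

  solve = Solver.solve

  ≡⇒≈ : ∀ {a b} → a ≡ b → a ≈ b
  ≡⇒≈ ≡.refl = refl

  -- Membership in an ideal.  Polynomial consequences of equations are obtained
  -- by exhibiting the cofactors k, so that only a ring identity remains.

  combine₁ : ∀ {a} k {h} → a ≈ k * h → h ≈ 0# → a ≈ 0#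
  combine₁ k a≈ h≈0 = trans a≈ (trans (*-congˡ h≈0) (zeroʳ k))

  combine₂ : ∀ {a} k {h} k′ {h′} → a ≈ k * h + k′ * h′ → h ≈ 0# → h′ ≈ 0# → a ≈ 0#
  combine₂ k k′ a≈ h≈0 h′≈0 =
    trans a≈ (trans (+-cong (combine₁ k refl h≈0) (combine₁ k′ refl h′≈0)) (+-identityˡ 0#))

  combine₃ : ∀ {a} k {h} k′ {h′} k″ {h″} → a ≈ k * h + k′ * h′ + k″ * h″ →
             h ≈ 0# → h′ ≈ 0# → h″ ≈ 0# → a ≈ 0#
  combine₃ k k′ k″ a≈ h≈0 h′≈0 h″≈0 =
    trans a≈ (trans (+-cong (combine₂ k k′ refl h≈0 h′≈0) (combine₁ k″ refl h″≈0))
                    (+-identityˡ 0#))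

  -≈0⇒≈ : ∀ {a b} → a - b ≈ 0# → a ≈ b
  -≈0⇒≈ = x∙y⁻¹≈ε⇒x≈y _ _

  ≈⇒-≈0 : ∀ {a b} → a ≈ b → a - b ≈ 0#
  ≈⇒-≈0 {_} {b} a≈b = trans (+-congʳ a≈b) (-‿inverseʳ b)

module _ {k : CommutativeRing 0ℓ 0ℓ} {n c} (E : Vector (Poly (CommutativeRing.Carrier k) n) c) where
  private
    module k = CommutativeRing k
    module Q = CommutativeRing (quotientRing k E)

  con-homo : IsHom k (quotientRing k E) con
  con-homo = record
    { isSemiringHomomorphism = record
      { isNearSemiringHomomorphism = record
        { +-isMonoidHomomorphism = record
          { isMagmaHomomorphism = record
            { isRelHomomorphism = record { cong = con-cong }
            ; homo = con-+ }
          ; ε-homo = ≈-refl }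
        ; *-homo = con-* }
      ; 1#-homo = ≈-refl }
    ; -‿homo = λ a → RingProperties.+-inverseˡ-unique Q.ring (con (k.- a)) (con a)
        (Q.trans (Q.sym (con-+ _ _)) (con-cong (k.-‿inverseˡ a))) }

id-homo : ∀ R → IsHom R R id
id-homo R = Identity.isRingHomomorphism (CommutativeRing.rawRing R) (CommutativeRing.refl R)

-- Polynomials over A modulo the ideal generated by E.
quotientAlgebra : (A : ℚ-Algebra) → ∀ {n c} →
                  Vector (Poly (ℚ-Algebra.Carrier A) n) c → ℚ-Algebra
quotientAlgebra A E = record
  { commutativeRing = quotientRing A.commutativeRing E
  ; ι = con ∘ A.ι
  ; ι-homo = Composition.isRingHomomorphism ≈-trans A.ι-homo (con-homo E) }
  where module A = ℚ-Algebra A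

ℚ-algebra : ℚ-Algebra
ℚ-algebra = record { commutativeRing = ℚ-ring ; ι = id ; ι-homo = id-homo ℚ-ring }

extensionAlgebra : Extension → ℚ-Algebra
extensionAlgebra K = record
  { commutativeRing = Extension.commutativeRing K
  ; ι = Extension.ι K ; ι-homo = Extension.ι-homo K }

-- Polynomial relations are preserved by evaluation at their solutions.

module _ (k R : CommutativeRing 0ℓ 0ℓ)
         {h : CommutativeRing.Carrier k → CommutativeRing.Carrier R} (h-homo : IsHom k R h) where
  private module k = CommutativeRing k
  open CommutativeRing R
  open RingMorphisms.IsRingHomomorphism h-homo
    using (⟦⟧-cong; +-homo; *-homo; 0#-homo; 1#-homo)

  eval-sound : ∀ {n c} {E : Vector (Poly k.Carrier n) c} (ρ : Vector Carrier n) →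
               (∀ i → eval rawRing h ρ (E i) ≈ 0#) →
               ∀ {p q} → _⊢_≈_ k E p q → eval rawRing h ρ p ≈ eval rawRing h ρ q
  eval-sound {E = E} ρ sat = go
    where
    go : ∀ {p q} → _⊢_≈_ k E p q → eval rawRing h ρ p ≈ eval rawRing h ρ q
    go ≈-refl            = refl
    go (≈-sym e)         = sym (go e)
    go (≈-trans e f)     = trans (go e) (go f)
    go (⊕-cong e f)      = +-cong (go e) (go f)
    go (⊗-cong e f)      = *-cong (go e) (go f)
    go (⊝-cong e)        = -‿cong (go e)
    go (⊕-assoc p q r)   = +-assoc _ _ _
    go (⊕-comm p q)      = +-comm _ _
    go (⊕-identityˡ p)   = trans (+-congʳ 0#-homo) (+-identityˡ _)
    go (⊝-inverseˡ p)    = trans (-‿inverseˡ _) (sym 0#-homo)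
    go (⊗-assoc p q r)   = *-assoc _ _ _
    go (⊗-comm p q)      = *-comm _ _
    go (⊗-identityˡ p)   = trans (*-congʳ 1#-homo) (*-identityˡ _)
    go (⊗-distribˡ p q r) = distribˡ _ _ _
    go (con-cong e)      = ⟦⟧-cong e
    go (con-+ a b)       = +-homo a b
    go (con-* a b)       = *-homo a b
    go (relation i)      = trans (sat i) (sym 0#-homo)

module _ {A : Set} (R : CommutativeRing 0ℓ 0ℓ) (h : A → CommutativeRing.Carrier R) where
  open CommutativeRing R

  eval-cong : ∀ {n} {ρ ρ′ : Vector Carrier n} → (∀ i → ρ i ≈ ρ′ i) →
              ∀ p → eval rawRing h ρ p ≈ eval rawRing h ρ′ p
  eval-cong e (con a) = refl
  eval-cong e (var i) = e i
  eval-cong e (p ⊕ q) = +-cong (eval-cong e p) (eval-cong e q)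
  eval-cong e (p ⊗ q) = *-cong (eval-cong e p) (eval-cong e q)
  eval-cong e (⊝ p)   = -‿cong (eval-cong e p)

-- Substitution of polynomials, with a change of coefficients.
substitute : ∀ {A : Set} (S : RawRing 0ℓ 0ℓ) → (A → RawRing.Carrier S) →
             ∀ {m n} → Vector (Poly (RawRing.Carrier S) n) m →
             Poly A m → Poly (RawRing.Carrier S) n
substitute S g {n = n} = eval (polyRawRing S n) (con ∘ g)

module _ {A : Set} (S R : RawRing 0ℓ 0ℓ)
         (g : A → RawRing.Carrier S) (h : RawRing.Carrier S → RawRing.Carrier R)
         {m n} (ρ : Vector (RawRing.Carrier R) n) (σ : Vector (Poly (RawRing.Carrier S) n) m) where
  open RawRing R

  eval-substitute : (p : Poly A m) →
    eval R h ρ (substitute S g σ p) ≡ eval R (h ∘ g) (eval R h ρ ∘ σ) p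
  eval-substitute (con a) = ≡.refl
  eval-substitute (var i) = ≡.refl
  eval-substitute (p ⊕ q) = ≡.cong₂ _+_ (eval-substitute p) (eval-substitute q)
  eval-substitute (p ⊗ q) = ≡.cong₂ _*_ (eval-substitute p) (eval-substitute q)
  eval-substitute (⊝ p)   = ≡.cong -_ (eval-substitute p)

module _ {A : Set} (k : CommutativeRing 0ℓ 0ℓ) (g : A → CommutativeRing.Carrier k)
         {n c} (E : Vector (Poly (CommutativeRing.Carrier k) n) c) where

  -- Substitution is evaluation in the quotient ring.
  eval-quotient : ∀ {m} {σ : Vector (Poly (CommutativeRing.Carrier k) n) m} p →
                  eval (CommutativeRing.rawRing (quotientRing k E)) (con ∘ g) σ p ≡
                  substitute (CommutativeRing.rawRing k) g σ p
  eval-quotient (con a) = ≡.refl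
  eval-quotient (var i) = ≡.refl
  eval-quotient (p ⊕ q) = ≡.cong₂ _⊕_ (eval-quotient p) (eval-quotient q)
  eval-quotient (p ⊗ q) = ≡.cong₂ _⊗_ (eval-quotient p) (eval-quotient q)
  eval-quotient (⊝ p)   = ≡.cong ⊝_ (eval-quotient p)

module _ (S : RawRing 0ℓ 0ℓ) where

  substitute-var : ∀ {n} (p : Poly (RawRing.Carrier S) n) → substitute S id var p ≡ p
  substitute-var (con a) = ≡.refl
  substitute-var (var i) = ≡.refl
  substitute-var (p ⊕ q) = ≡.cong₂ _⊕_ (substitute-var p) (substitute-var q)
  substitute-var (p ⊗ q) = ≡.cong₂ _⊗_ (substitute-var p) (substitute-var q)
  substitute-var (⊝ p)   = ≡.cong ⊝_ (substitute-var p)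

module _ (k : CommutativeRing 0ℓ 0ℓ) where
  private module k = CommutativeRing k

  substitute-sound : ∀ {m n c d} {E : Vector (Poly k.Carrier m) c} (F : Vector (Poly k.Carrier n) d)
                     {σ : Vector (Poly k.Carrier n) m} →
                     (∀ i → _⊢_≈_ k F (substitute k.rawRing id σ (E i)) (con k.0#)) →
                     ∀ {p q} → _⊢_≈_ k E p q →
                     _⊢_≈_ k F (substitute k.rawRing id σ p) (substitute k.rawRing id σ q)
  substitute-sound {E = E} F {σ} sat {p} {q} e =
    ≡.subst₂ (_⊢_≈_ k F) (eval-quotient k id F p) (eval-quotient k id F q)
      (eval-sound k (quotientRing k F) (con-homo F) σ
        (λ i → ≡.subst (λ r → _⊢_≈_ k F r (con k.0#)) (≡.sym (eval-quotient k id F (E i)))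
                       (sat i)) e)

  -- Congruence modulo an ideal implies congruence modulo a larger one.
  enlarge : ∀ {n c d} (E : Vector (Poly k.Carrier n) c) (F : Vector (Poly k.Carrier n) d) →
            (∀ i → _⊢_≈_ k F (E i) (con k.0#)) → ∀ {p q} → _⊢_≈_ k E p q → _⊢_≈_ k F p q
  enlarge E F sat {p} {q} e =
    ≡.subst₂ (_⊢_≈_ k F) (substitute-var k.rawRing p) (substitute-var k.rawRing q)
      (substitute-sound {E = E} F {var}
        (λ i → ≡.subst (λ r → _⊢_≈_ k F r (con k.0#)) (≡.sym (substitute-var k.rawRing (E i)))
                       (sat i)) e)

-- Generic points over an extension of ℚ

module ExtensionFacts (K : Extension) where
  open ℚ-Algebra (extensionAlgebra K) public
  open Extension K public using (_≈?_; 1≉0; invertible)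

  *-zero-cancel : ∀ {x y} → ¬ x ≈ 0# → x * y ≈ 0# → y ≈ 0#
  *-zero-cancel {x} {y} x≉0 xy≈0 with invertible x x≉0
  ... | z , zx≈1 = begin
    y           ≈⟨ *-identityˡ y ⟨
    1# * y      ≈⟨ *-congʳ zx≈1 ⟨
    z * x * y   ≈⟨ *-assoc z x y ⟩
    z * (x * y) ≈⟨ *-congˡ xy≈0 ⟩
    z * 0#      ≈⟨ zeroʳ z ⟩
    0#          ∎
    where open SetoidReasoning setoid

  *-≉0 : ∀ {x y} → ¬ x ≈ 0# → ¬ y ≈ 0# → ¬ x * y ≈ 0#
  *-≉0 x≉0 y≉0 xy≈0 = y≉0 (*-zero-cancel x≉0 xy≈0)

  invertible⇒≉0 : ∀ {x y} → x * y ≈ 1# → ¬ y ≈ 0#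
  invertible⇒≉0 {x} xy≈1 y≈0 = 1≉0 (trans (sym xy≈1) (trans (*-congˡ y≈0) (zeroʳ x)))

  square≈0⇒≈0 : ∀ {x} → x * x ≈ 0# → x ≈ 0#
  square≈0⇒≈0 {x} xx≈0 with x ≈? 0#
  ... | yes x≈0 = x≈0
  ... | no  x≉0 = *-zero-cancel x≉0 xx≈0

  ι-≉0 : ∀ {a} → a ≢ 0ℚ → ¬ ι a ≈ 0#
  ι-≉0 {a} a≢0 = invertible⇒≉0 {ι (ℚ.1/ a)} (begin
    ι (ℚ.1/ a) * ι a ≈⟨ *-homo _ _ ⟨
    ι (ℚ.1/ a ℚ.* a) ≈⟨ ι-cong (ℚ.*-inverseˡ a) ⟩
    ι 1ℚ             ≈⟨ 1#-homo ⟩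
    1#               ∎)
    where
    open SetoidReasoning setoid
    instance _ = ℚ.≢-nonZero a≢0

  ι-injective : ∀ {a b} → ι a ≈ ι b → a ≡ b
  ι-injective {a} {b} ιa≈ιb with a ≟ℚ b
  ... | yes a≡b = a≡b
  ... | no  a≢b = contradiction
    (trans (+-homo a (ℚ.- b)) (trans (+-congˡ (-‿homo b)) (≈⇒-≈0 ιa≈ιb)))
    (ι-≉0 (a≢b ∘ ℚ-≡))
    where
    ℚ-≡ : a ℚ.- b ≡ 0ℚ → a ≡ b
    ℚ-≡ = ℚ-Algebra.-≈0⇒≈ ℚ-algebra

  -- A property of the elements of K holds cofinitely if it holds outside some
  -- finite list.  The double negation stands for classical reasoning: a
  -- nonzero polynomial has finitely many roots, but they cannot be listed
  -- without a factorisation algorithm.  It is harmless since generic points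
  -- are only used to derive contradictions.

  Avoids : List Carrier → Carrier → Set
  Avoids L s = All (λ r → ¬ s ≈ r) L

  Cofinitely : (Carrier → Set) → Set
  Cofinitely P = ¬ ¬ (∃[ L ] ∀ s → Avoids L s → P s)

  cofinitely-map : ∀ {P Q} → (∀ s → P s → Q s) → Cofinitely P → Cofinitely Q
  cofinitely-map f cofP k = cofP λ (L , p) → k (L , λ s → f s ∘ p s)

  cofinitely-∩ : ∀ {P Q} → Cofinitely P → Cofinitely Q → Cofinitely (λ s → P s × Q s)
  cofinitely-∩ cofP cofQ k = cofP λ (L , p) → cofQ λ (M , q) →
    k (L ++ M , λ s a → p s (++⁻ˡ L a) , q s (++⁻ʳ L a))

  cofinitely-always : ∀ {P} → (∀ s → P s) → Cofinitely P
  cofinitely-always p k = k ([] , λ s _ → p s)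

  cofinitely-≉ : ∀ r → Cofinitely (λ s → ¬ s ≈ r)
  cofinitely-≉ r k = k (r ∷ [] , λ { s (s≉r ∷ []) → s≉r })

  -- If each value is taken on a finite set only, then cofinite sets have
  -- cofinite preimages.  (For a relation T in place of a function.)
  cofinitely-preimage : ∀ {P} (T : Carrier → Carrier → Set) →
    (∀ r → Cofinitely (λ s → ∀ x → T s x → ¬ x ≈ r)) →
    Cofinitely P → Cofinitely (λ s → ∀ x → T s x → P x)
  cofinitely-preimage T finite cofP k = cofP λ (L , p) →
    avoiding L λ (M , q) → k (M , λ s a x t → p x (q s a x t))
    where
    avoiding : ∀ L → Cofinitely (λ s → ∀ x → T s x → Avoids L x)
    avoiding []      = cofinitely-always λ _ _ _ → []
    avoiding (r ∷ L) = cofinitely-map (λ s (p , q) x t → p x t ∷ q x t)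
      (cofinitely-∩ (finite r) (avoiding L))

  -- K is infinite, having characteristic zero: among the natural numbers, all
  -- sufficiently large ones avoid a given list.

  nat : ℕ → Carrier
  nat m = ι (fromℤ (+ m))

  nat-injective : ∀ {l m} → nat l ≈ nat m → l ≡ m
  nat-injective e = +-injective (≡.cong ℚ.ℚ.numerator (ι-injective e))

  cofinitely-∃ : ∀ {P} → Cofinitely P → ¬ ¬ (∃[ s ] P s)
  cofinitely-∃ cofP k = cofP λ (L , p) → eventually L λ (N , a) → k (nat N , p _ (a N ≤-refl))
    where
    eventually : ∀ L → ¬ ¬ (∃[ N ] ∀ m → N ≤ m → Avoids L (nat m))
    eventually []      k = k (0 , λ _ _ → [])
    eventually (r ∷ L) k = eventually L λ (N , a) →
      k (N , λ m N≤m → (λ m≈r → k (suc m ⊔ N , λ l le →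
             (λ l≈r → <⇒≢ (m⊔n≤o⇒m≤o (suc m) N le) (nat-injective (trans m≈r (sym l≈r))))
             ∷ a l (m⊔n≤o⇒n≤o (suc m) N le)))
           ∷ a m N≤m)

  -- The value at s of the univariate polynomial with the given coefficients,
  -- constant term first.
  horner : List Carrier → Carrier → Carrier
  horner []       s = 0#
  horner (c ∷ cs) s = c + s * horner cs s

  -- Some coefficient is nonzero.
  NonZero : List Carrier → Set
  NonZero = Any (λ c → ¬ c ≈ 0#)

  nonZero? : ∀ cs → Dec (NonZero cs)
  nonZero? = any? (λ c → ¬? (c ≈? 0#))

  horner-zero : ∀ {cs} s → ¬ NonZero cs → horner cs s ≈ 0#
  horner-zero {[]}     s z = refl
  horner-zero {c ∷ cs} s z with c ≈? 0#
  ... | no  c≉0 = contradiction (here c≉0) z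
  ... | yes c≈0 = trans (+-cong c≈0 (trans (*-congˡ (horner-zero s (z ∘ there))) (zeroʳ s)))
                        (+-identityˡ 0#)

  -- The coefficients of (f (s) - f (r)) / (s - r), where cs are those of f
  -- without its constant term.
  deflate : Carrier → List Carrier → List Carrier
  deflate r []       = []
  deflate r (c ∷ cs) = horner (c ∷ cs) r ∷ deflate r cs

  length-deflate : ∀ r cs → length (deflate r cs) ≡ length cs
  length-deflate r []       = ≡.refl
  length-deflate r (c ∷ cs) = ≡.cong suc (length-deflate r cs)

  horner-deflate : ∀ r s c cs →
    horner (c ∷ cs) s ≈ horner (c ∷ cs) r + (s - r) * horner (deflate r cs) s
  horner-deflate r s c [] =
    trans (+-congˡ (trans (zeroʳ s) (sym (zeroʳ r))))
          (sym (trans (+-congˡ (zeroʳ (s - r))) (+-identityʳ _)))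
  horner-deflate r s c (c′ ∷ cs) = trans (+-congˡ (*-congˡ (horner-deflate r s c′ cs)))
    (solve 5 (λ r s c h d → c :+ s :* (h :+ (s :- r) :* d) :=
                            c :+ r :* h :+ (s :- r) :* (h :+ s :* d))
      refl r s c (horner (c′ ∷ cs) r) (horner (deflate r cs) s))

  nonZero-tail : ∀ {r c cs} → horner (c ∷ cs) r ≈ 0# → NonZero (c ∷ cs) → NonZero cs
  nonZero-tail e (there nz) = nz
  nonZero-tail {r} {c} {cs} e (here c≉0) with nonZero? cs
  ... | yes nz = nz
  ... | no  z  = contradiction
    (trans (sym (trans (+-congˡ (trans (*-congˡ (horner-zero r z)) (zeroʳ r))) (+-identityʳ c))) e)
    c≉0

  nonZero-deflate : ∀ r {cs} → NonZero cs → NonZero (deflate r cs)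
  nonZero-deflate r {c ∷ cs} nz with horner (c ∷ cs) r ≈? 0#
  ... | no  h≉0 = here h≉0
  ... | yes h≈0 = there (nonZero-deflate r (nonZero-tail h≈0 nz))

  -- A nonzero polynomial has finitely many roots.
  horner-≉0 : ∀ {cs} → NonZero cs → Cofinitely (λ s → ¬ horner cs s ≈ 0#)
  horner-≉0 nz = go _ _ ≡.refl nz
    where
    -- Either there is no root, or division by the linear factor of a root
    -- lowers the degree.
    go : ∀ m cs → length cs ≡ m → NonZero cs → Cofinitely (λ s → ¬ horner cs s ≈ 0#)
    go (suc m) (c ∷ cs) len nz k = k ([] , λ r _ root →
      go m (deflate r cs) (≡.trans (length-deflate r cs) (suc-injective len))
         (nonZero-deflate r (nonZero-tail root nz)) λ (L , f) →
      k (r ∷ L , λ { s (s≉r ∷ a) root′ → f s a (*-zero-cancel (s≉r ∘ -≈0⇒≈)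
        (trans (sym (+-identityˡ _)) (trans (+-congʳ (sym root))
          (trans (sym (horner-deflate r s c cs)) root′)))) }))

  -- The analogue in m variables.  The last variable is chosen first, and the
  -- finite list excluded for a variable may depend on the variables after it.
  Generically : ∀ m → (Vector Carrier m → Set) → Set
  Generically zero    P = P Vec.[]
  Generically (suc m) P = Generically m (λ ρ → Cofinitely (λ s → P (s Vec.∷ ρ)))

  generically-map : ∀ m {P Q} → (∀ ρ → P ρ → Q ρ) → Generically m P → Generically m Q
  generically-map zero    f = f _
  generically-map (suc m) f = generically-map m (λ ρ → cofinitely-map (λ s → f _))

  generically-∩ : ∀ m {P Q} → Generically m P → Generically m Q →
                  Generically m (λ ρ → P ρ × Q ρ)
  generically-∩ zero    p q = p , q
  generically-∩ (suc m) p q =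
    generically-map m (λ ρ (p , q) → cofinitely-∩ p q) (generically-∩ m p q)

  generically-∃ : ∀ m {P} → Generically m P → ¬ ¬ (∃[ ρ ] P ρ)
  generically-∃ zero    p k = k (_ , p)
  generically-∃ (suc m) p k = generically-∃ m p λ (ρ , cof) → cofinitely-∃ cof λ (s , p) → k (_ , p)

  infix 4 _≋_

  -- Equality of polynomials, as opposed to expressions.
  _≋_ : ∀ {m} → Poly Carrier m → Poly Carrier m → Set
  p ≋ q = _⊢_≈_ commutativeRing Vec.[] p q

  value : ∀ {m} → Vector Carrier m → Poly Carrier m → Carrier
  value = eval rawRing id

  value-sound : ∀ {m c} {E : Vector (Poly Carrier m) c} ρ → (∀ i → value ρ (E i) ≈ 0#) →
                ∀ {p q} → _⊢_≈_ commutativeRing E p q → value ρ p ≈ value ρ q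
  value-sound = eval-sound commutativeRing commutativeRing (id-homo commutativeRing)

  private module 𝔸 (m : ℕ) = ℚ-Algebra (quotientAlgebra (extensionAlgebra K) {n = m} Vec.[])

  -- A polynomial in the variables numbered from one.
  shift : ∀ {m} → Poly Carrier m → Poly Carrier (suc m)
  shift = substitute rawRing id (λ i → var (suc i))

  shift-cong : ∀ {m} {p q : Poly Carrier m} → p ≋ q → shift p ≋ shift q
  shift-cong = substitute-sound commutativeRing Vec.[] (λ ())

  -- The polynomial in one more variable, numbered zero, with the given
  -- coefficients.
  fromCoeffs : ∀ {m} → List (Poly Carrier m) → Poly Carrier (suc m)
  fromCoeffs []       = con 0#
  fromCoeffs (c ∷ cs) = shift c ⊕ var zero ⊗ fromCoeffs cs

  -- Arithmetic on lists of coefficients.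

  infixl 6 _+ᶜ_
  infixl 7 _·ᶜ_ _*ᶜ_

  _+ᶜ_ _*ᶜ_ : ∀ {m} → List (Poly Carrier m) → List (Poly Carrier m) → List (Poly Carrier m)
  []       +ᶜ ds       = ds
  (c ∷ cs) +ᶜ []       = c ∷ cs
  (c ∷ cs) +ᶜ (d ∷ ds) = c ⊕ d ∷ cs +ᶜ ds

  _·ᶜ_ : ∀ {m} → Poly Carrier m → List (Poly Carrier m) → List (Poly Carrier m)
  c ·ᶜ ds = List.map (c ⊗_) ds

  []       *ᶜ ds = []
  (c ∷ cs) *ᶜ ds = c ·ᶜ ds +ᶜ (con 0# ∷ cs *ᶜ ds)

  -- The coefficients of a polynomial with respect to the first variable.
  coeffs : ∀ {m} → Poly Carrier (suc m) → List (Poly Carrier m)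
  coeffs (con a)       = con a ∷ []
  coeffs (var zero)    = con 0# ∷ con 1# ∷ []
  coeffs (var (suc i)) = var i ∷ []
  coeffs (p ⊕ q)       = coeffs p +ᶜ coeffs q
  coeffs (p ⊗ q)       = coeffs p *ᶜ coeffs q
  coeffs (⊝ p)         = (⊝ con 1#) ·ᶜ coeffs p

  module _ {m : ℕ} where
    private
      module A = 𝔸 (suc m)
      x : Poly Carrier (suc m)
      x = var zero
    open SetoidReasoning A.setoid

    fromCoeffs-+ : ∀ (cs ds : List (Poly Carrier m)) →
                   fromCoeffs (cs +ᶜ ds) ≋ fromCoeffs cs ⊕ fromCoeffs ds
    fromCoeffs-+ []       ds       = A.sym (A.+-identityˡ _)
    fromCoeffs-+ (c ∷ cs) []       = A.sym (A.+-identityʳ _)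
    fromCoeffs-+ (c ∷ cs) (d ∷ ds) = A.trans (A.+-congˡ (A.*-congˡ (fromCoeffs-+ cs ds)))
      (A.solve 5 (λ x c d p q → c A.:+ d A.:+ x A.:* (p A.:+ q) A.:=
                                c A.:+ x A.:* p A.:+ (d A.:+ x A.:* q))
        A.refl x (shift c) (shift d) (fromCoeffs cs) (fromCoeffs ds))

    fromCoeffs-· : ∀ c (ds : List (Poly Carrier m)) →
                   fromCoeffs (c ·ᶜ ds) ≋ shift c ⊗ fromCoeffs ds
    fromCoeffs-· c []       = A.sym (A.zeroʳ _)
    fromCoeffs-· c (d ∷ ds) = A.trans (A.+-congˡ (A.*-congˡ (fromCoeffs-· c ds)))
      (A.solve 4 (λ x c d p → c A.:* d A.:+ x A.:* (c A.:* p) A.:= c A.:* (d A.:+ x A.:* p))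
        A.refl x (shift c) (shift d) (fromCoeffs ds))

    fromCoeffs-* : ∀ (cs ds : List (Poly Carrier m)) →
                   fromCoeffs (cs *ᶜ ds) ≋ fromCoeffs cs ⊗ fromCoeffs ds
    fromCoeffs-* []       ds = A.sym (A.zeroˡ _)
    fromCoeffs-* (c ∷ cs) ds = begin
      fromCoeffs (c ·ᶜ ds +ᶜ (con 0# ∷ cs *ᶜ ds))
        ≈⟨ fromCoeffs-+ (c ·ᶜ ds) (con 0# ∷ cs *ᶜ ds) ⟩
      fromCoeffs (c ·ᶜ ds) ⊕ (con 0# ⊕ x ⊗ fromCoeffs (cs *ᶜ ds))
        ≈⟨ A.+-cong (fromCoeffs-· c ds)
             (A.trans (A.+-identityˡ _) (A.*-congˡ (fromCoeffs-* cs ds))) ⟩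
      shift c ⊗ fromCoeffs ds ⊕ x ⊗ (fromCoeffs cs ⊗ fromCoeffs ds)
        ≈⟨ A.solve 4 (λ x c p q → c A.:* q A.:+ x A.:* (p A.:* q) A.:= (c A.:+ x A.:* p) A.:* q)
             A.refl x (shift c) (fromCoeffs cs) (fromCoeffs ds) ⟩
      fromCoeffs (c ∷ cs) ⊗ fromCoeffs ds ∎

    fromCoeffs-const : ∀ (c : Poly Carrier m) → shift c ≋ fromCoeffs (c ∷ [])
    fromCoeffs-const c = A.sym (A.trans (A.+-congˡ (A.zeroʳ x)) (A.+-identityʳ _))

    fromCoeffs-coeffs : ∀ (p : Poly Carrier (suc m)) → p ≋ fromCoeffs (coeffs p)
    fromCoeffs-coeffs (con a)       = fromCoeffs-const (con a)
    fromCoeffs-coeffs (var (suc i)) = fromCoeffs-const (var i)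
    fromCoeffs-coeffs (var zero)    = A.sym (A.trans (A.+-identityˡ _)
      (A.trans (A.*-congˡ (A.sym (fromCoeffs-const (con 1#)))) (A.*-identityʳ x)))
    fromCoeffs-coeffs (p ⊕ q) = A.sym (A.trans (fromCoeffs-+ (coeffs p) (coeffs q))
      (A.sym (A.+-cong (fromCoeffs-coeffs p) (fromCoeffs-coeffs q))))
    fromCoeffs-coeffs (p ⊗ q) = A.sym (A.trans (fromCoeffs-* (coeffs p) (coeffs q))
      (A.sym (A.*-cong (fromCoeffs-coeffs p) (fromCoeffs-coeffs q))))
    fromCoeffs-coeffs (⊝ p) = begin
      ⊝ p                               ≈⟨ A.-‿cong (fromCoeffs-coeffs p) ⟩
      ⊝ fromCoeffs (coeffs p)           ≈⟨ A.-1*x≈-x _ ⟨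
      ⊝ con 1# ⊗ fromCoeffs (coeffs p)  ≈⟨ fromCoeffs-· (⊝ con 1#) (coeffs p) ⟨
      fromCoeffs (⊝ con 1# ·ᶜ coeffs p) ∎

  value-shift : ∀ {m} s (ρ : Vector Carrier m) p → value (s Vec.∷ ρ) (shift p) ≈ value ρ p
  value-shift s ρ p = ≡⇒≈ (eval-substitute rawRing rawRing id id (s Vec.∷ ρ) (λ i → var (suc i)) p)

  value-fromCoeffs : ∀ {m} s (ρ : Vector Carrier m) cs →
                     value (s Vec.∷ ρ) (fromCoeffs cs) ≈ horner (List.map (value ρ) cs) s
  value-fromCoeffs s ρ []       = refl
  value-fromCoeffs s ρ (c ∷ cs) =
    +-cong (value-shift s ρ c) (*-congˡ (value-fromCoeffs s ρ cs))

  value-constant : ∀ {ρ} (p : Poly Carrier 0) → p ≋ con (value ρ p)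
  value-constant (con a) = ≈-refl
  value-constant (p ⊕ q) = ≈-trans (⊕-cong (value-constant p) (value-constant q)) (≈-sym (con-+ _ _))
  value-constant (p ⊗ q) = ≈-trans (⊗-cong (value-constant p) (value-constant q)) (≈-sym (con-* _ _))
  value-constant (⊝ p)   = ≈-trans (⊝-cong (value-constant p)) (≈-sym (-‿homo-con _))
    where
    open RingMorphisms.IsRingHomomorphism (con-homo {k = commutativeRing} {n = 0} Vec.[])
      renaming (-‿homo to -‿homo-con)

  -- The decision that makes the zero product property constructive: it rests
  -- on deciding whether the scalar coefficients of p vanish.
  zero-or-generically-≉0 : ∀ m (p : Poly Carrier m) →
    p ≋ con 0# ⊎ Generically m (λ ρ → ¬ value ρ p ≈ 0#)
  zero-or-generically-≉0 zero p with value Vec.[] p ≈? 0#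
  ... | yes v≈0 = inj₁ (≈-trans (value-constant p) (con-cong v≈0))
  ... | no  v≉0 = inj₂ v≉0
  zero-or-generically-≉0 (suc m) p with go (coeffs p)
    where
    go : (cs : List (Poly Carrier m)) →
         fromCoeffs cs ≋ con 0# ⊎ Generically m (λ ρ → NonZero (List.map (value ρ) cs))
    go [] = inj₁ ≈-refl
    go (c ∷ cs) with zero-or-generically-≉0 m c | go cs
    ... | inj₂ c≉0 | _          = inj₂ (generically-map m (λ _ → here) c≉0)
    ... | inj₁ _   | inj₂ cs≉0 = inj₂ (generically-map m (λ _ → there) cs≉0)
    ... | inj₁ c≈0 | inj₁ cs≈0 = inj₁ (A.trans
      (A.+-cong (shift-cong c≈0) (A.trans (A.*-congˡ cs≈0) (A.zeroʳ _))) (A.+-identityˡ _))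
      where module A = 𝔸 (suc m)
  ... | inj₁ cs≈0 = inj₁ (≈-trans (fromCoeffs-coeffs p) cs≈0)
  ... | inj₂ cs≉0 = inj₂ (generically-map m (λ ρ nz → cofinitely-map (λ s h≉0 v≈0 →
      h≉0 (trans (sym (trans (value-sound _ (λ ()) (fromCoeffs-coeffs p))
                             (value-fromCoeffs s ρ (coeffs p)))) v≈0))
    (horner-≉0 nz)) cs≉0)

-- Fractions and normal forms

-- Polynomials in r = 1 / e and m further variables, e being a polynomial in the
-- latter.  They are fractions with a power of e as denominator.
module Fractions (K : Extension) where
  private
    module K = ExtensionFacts K
    k : CommutativeRing 0ℓ 0ℓ
    k = K.commutativeRing

  power : ∀ {m} → Poly K.Carrier m → ℕ → Poly K.Carrier m
  power e zero    = con K.1#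
  power e (suc N) = e ⊗ power e N

  -- The numerator of c₀ + c₁ r + c₂ r² + … over e ^ l, where l is the number of
  -- coefficients.
  numerator : ∀ {m} → Poly K.Carrier m → List (Poly K.Carrier m) → Poly K.Carrier m
  numerator e []       = con K.0#
  numerator e (c ∷ cs) = c ⊗ power e (suc (length cs)) ⊕ numerator e cs

  module _ {m} (e : Poly K.Carrier m) (R : CommutativeRing 0ℓ 0ℓ) {h} (h-homo : IsHom k R h) where
    open CommutativeRing R
    private
      ev : ∀ {l} → Vector Carrier l → Poly K.Carrier l → Carrier
      ev = eval rawRing h
      module H = RingMorphisms.IsRingHomomorphism h-homo
      A : ℚ-Algebra
      A = record { commutativeRing = R ; ι = h ∘ K.ι
                 ; ι-homo = Composition.isRingHomomorphism trans K.ι-homo h-homo }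
      module A = ℚ-Algebra A

    module _ (r : Carrier) (ρ : Vector Carrier m) (re≈1 : r * ev ρ e ≈ 1#) where
      private
        ev-shift : ∀ p → ev (r Vec.∷ ρ) (K.shift p) ≈ ev ρ p
        ev-shift p = A.≡⇒≈ (eval-substitute K.rawRing rawRing id h (r Vec.∷ ρ) (λ i → var (suc i)) p)

      power-cancel : ∀ N {x} → ev ρ (power e N) * x ≈ 0# → x ≈ 0#
      power-cancel zero    {x} ex≈0 = trans (sym (trans (*-congʳ H.1#-homo) (*-identityˡ x))) ex≈0
      power-cancel (suc N) {x} ex≈0 = power-cancel N (begin
        ev ρ (power e N) * x                  ≈⟨ *-identityˡ _ ⟨
        1# * (ev ρ (power e N) * x)           ≈⟨ *-congʳ re≈1 ⟨
        r * ev ρ e * (ev ρ (power e N) * x)   ≈⟨ A.solve 4 (λ r e p x →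
            r A.:* e A.:* (p A.:* x) A.:= r A.:* (e A.:* p A.:* x)) refl r (ev ρ e) _ x ⟩
        r * (ev ρ (power e (suc N)) * x)      ≈⟨ *-congˡ ex≈0 ⟩
        r * 0#                                ≈⟨ zeroʳ r ⟩
        0#                                    ∎)
        where open SetoidReasoning setoid

      numerator-correct : ∀ cs → ev ρ (power e (length cs)) * ev (r Vec.∷ ρ) (K.fromCoeffs cs)
                               ≈ ev ρ (numerator e cs)
      numerator-correct []       = trans (*-congˡ H.0#-homo) (trans (zeroʳ _) (sym H.0#-homo))
      numerator-correct (c ∷ cs) = begin
        ε * P * (ev (r Vec.∷ ρ) (K.shift c) + r * F) ≈⟨ *-congˡ (+-congʳ (ev-shift c)) ⟩
        ε * P * (ev ρ c + r * F)                     ≈⟨ A.solve 5 (λ ε P c r F →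
           ε A.:* P A.:* (c A.:+ r A.:* F) A.:= c A.:* (ε A.:* P) A.:+ r A.:* ε A.:* (P A.:* F))
           refl ε P (ev ρ c) r F ⟩
        ev ρ c * (ε * P) + r * ε * (P * F)           ≈⟨ +-congˡ (trans (*-congʳ re≈1) (*-identityˡ _)) ⟩
        ev ρ c * (ε * P) + P * F                     ≈⟨ +-congˡ (numerator-correct cs) ⟩
        ev ρ (numerator e (c ∷ cs))                  ∎
        where
        open SetoidReasoning setoid
        ε P F : Carrier
        ε = ev ρ e
        P = ev ρ (power e (length cs))
        F = ev (r Vec.∷ ρ) (K.fromCoeffs cs)

      numerator-coeffs : ∀ g → ev ρ (power e (length (K.coeffs g))) * ev (r Vec.∷ ρ) g
                             ≈ ev ρ (numerator e (K.coeffs g))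
      numerator-coeffs g = trans
        (*-congˡ (eval-sound k R h-homo (r Vec.∷ ρ) (λ ()) (K.fromCoeffs-coeffs g)))
        (numerator-correct (K.coeffs g))

      numerator≈0⇒≈0 : ∀ g → ev ρ (numerator e (K.coeffs g)) ≈ 0# → ev (r Vec.∷ ρ) g ≈ 0#
      numerator≈0⇒≈0 g n≈0 =
        power-cancel (length (K.coeffs g)) (trans (numerator-coeffs g) n≈0)

  -- At a generic point ρ of K ^ m, the value of g at (r , ρ) is nonzero for r the
  -- inverse of e (ρ).
  GenericallyNonzero : ∀ {m} → Poly K.Carrier m → Poly K.Carrier (suc m) → Set
  GenericallyNonzero {m} e g =
    K.Generically m (λ ρ → ∀ r → r K.* K.value ρ e K.≈ K.1# → ¬ K.value (r Vec.∷ ρ) g K.≈ K.0#)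

  -- The value of g at (r , ρ), where r is the inverse of e (ρ), vanishes in every
  -- K-algebra.
  record Vanishes {m} (e : Poly K.Carrier m) (g : Poly K.Carrier (suc m)) : Set₁ where
    field
      vanishes : ∀ (R : CommutativeRing 0ℓ 0ℓ) {h} → IsHom k R h → let open CommutativeRing R in
                 ∀ r ρ → r * eval rawRing h ρ e ≈ 1# → eval rawRing h (r Vec.∷ ρ) g ≈ 0#
  open Vanishes public

  vanishes-or-generically-nonzero : ∀ {m} (e : Poly K.Carrier m) g →
                                    Vanishes e g ⊎ GenericallyNonzero e g
  vanishes-or-generically-nonzero {m} e g with K.zero-or-generically-≉0 m (numerator e (K.coeffs g))
  ... | inj₁ n≈0 = inj₁ record { vanishes = λ R h-homo r ρ re≈1 →
      let open CommutativeRing R in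
      numerator≈0⇒≈0 e R h-homo r ρ re≈1 g
        (trans (eval-sound k R h-homo ρ (λ ()) n≈0)
               (RingMorphisms.IsRingHomomorphism.0#-homo h-homo)) }
  ... | inj₂ n≉0 = inj₂ (K.generically-map m (λ ρ v≉0 r re≈1 g≈0 → v≉0
      (K.trans (K.sym (numerator-coeffs e k (id-homo k) r ρ re≈1 g))
               (K.trans (K.*-congˡ g≈0) (K.zeroʳ _)))) n≉0)

-- In the ring defined by E, let u² and v² be polynomials in b.  Every element
-- generated by b, u and v is then a combination of 1, u, v and u v whose
-- coefficients are polynomials in b.
module NormalForm (K : Extension) {n c} (E : Vector (Poly (Extension.Carrier K) n) c)
  (b : Vector (Poly (Extension.Carrier K) n) 3) (u v : Poly (Extension.Carrier K) n)
  (U V : Poly (Extension.Carrier K) 3)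
  where

  private
    module K = ExtensionFacts K
    k : CommutativeRing 0ℓ 0ℓ
    k = K.commutativeRing
    Coeff : Set
    Coeff = Poly K.Carrier 3
    module Q = ℚ-Algebra (quotientAlgebra (extensionAlgebra K) E)
  open Q using (_≈_)

  -- The value at b of a coefficient.
  base : Coeff → Poly K.Carrier n
  base = substitute K.rawRing id b

  combination : Coeff → Coeff → Coeff → Coeff → Poly K.Carrier n
  combination α β γ δ = base α ⊕ base β ⊗ u ⊕ base γ ⊗ v ⊕ base δ ⊗ (u ⊗ v)

  record NF (f : Poly K.Carrier n) : Set where
    constructor nf
    field
      α β γ δ : Coeff
      correct : f ≈ combination α β γ δ

  nf-base : ∀ α → NF (base α)
  nf-base α = nf α o o o (Q.sym (begin
    base α ⊕ con K.0# ⊗ u ⊕ con K.0# ⊗ v ⊕ con K.0# ⊗ (u ⊗ v)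
      ≈⟨ Q.+-cong (Q.+-cong (Q.+-congˡ (Q.zeroˡ u)) (Q.zeroˡ v)) (Q.zeroˡ _) ⟩
    base α ⊕ con K.0# ⊕ con K.0# ⊕ con K.0#
      ≈⟨ Q.trans (Q.+-identityʳ _) (Q.trans (Q.+-identityʳ _) (Q.+-identityʳ _)) ⟩
    base α ∎))
    where
    open SetoidReasoning Q.setoid
    o : Coeff
    o = con K.0#

  nf-u : NF u
  nf-u = nf o (con K.1#) o o (Q.sym (begin
    con K.0# ⊕ con K.1# ⊗ u ⊕ con K.0# ⊗ v ⊕ con K.0# ⊗ (u ⊗ v)
      ≈⟨ Q.+-cong (Q.+-cong (Q.+-congˡ (Q.*-identityˡ u)) (Q.zeroˡ v)) (Q.zeroˡ _) ⟩
    con K.0# ⊕ u ⊕ con K.0# ⊕ con K.0#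
      ≈⟨ Q.trans (Q.+-identityʳ _) (Q.trans (Q.+-identityʳ _) (Q.+-identityˡ _)) ⟩
    u ∎))
    where
    open SetoidReasoning Q.setoid
    o : Coeff
    o = con K.0#

  nf-v : NF v
  nf-v = nf o o (con K.1#) o (Q.sym (begin
    con K.0# ⊕ con K.0# ⊗ u ⊕ con K.1# ⊗ v ⊕ con K.0# ⊗ (u ⊗ v)
      ≈⟨ Q.+-cong (Q.+-cong (Q.+-congˡ (Q.zeroˡ u)) (Q.*-identityˡ v)) (Q.zeroˡ _) ⟩
    con K.0# ⊕ con K.0# ⊕ v ⊕ con K.0#
      ≈⟨ Q.trans (Q.+-identityʳ _) (Q.trans (Q.+-congʳ (Q.+-identityʳ _)) (Q.+-identityˡ _)) ⟩
    v ∎))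
    where
    open SetoidReasoning Q.setoid
    o : Coeff
    o = con K.0#

  nf-⊕ : ∀ {f g} → NF f → NF g → NF (f ⊕ g)
  nf-⊕ (nf α β γ δ f≈) (nf α′ β′ γ′ δ′ g≈) =
    nf (α ⊕ α′) (β ⊕ β′) (γ ⊕ γ′) (δ ⊕ δ′) (Q.trans (Q.+-cong f≈ g≈)
      (Q.solve 10 (λ u v a b c d a′ b′ c′ d′ →
         a Q.:+ b Q.:* u Q.:+ c Q.:* v Q.:+ d Q.:* (u Q.:* v) Q.:+
         (a′ Q.:+ b′ Q.:* u Q.:+ c′ Q.:* v Q.:+ d′ Q.:* (u Q.:* v)) Q.:=
         (a Q.:+ a′) Q.:+ (b Q.:+ b′) Q.:* u Q.:+ (c Q.:+ c′) Q.:* v Q.:+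
         (d Q.:+ d′) Q.:* (u Q.:* v))
       Q.refl u v (base α) (base β) (base γ) (base δ) (base α′) (base β′) (base γ′) (base δ′)))

  nf-⊝ : ∀ {f} → NF f → NF (⊝ f)
  nf-⊝ (nf α β γ δ f≈) =
    nf (⊝ α) (⊝ β) (⊝ γ) (⊝ δ) (Q.trans (Q.-‿cong f≈)
      (Q.solve 6 (λ u v a b c d →
         Q.:- (a Q.:+ b Q.:* u Q.:+ c Q.:* v Q.:+ d Q.:* (u Q.:* v)) Q.:=
         (Q.:- a) Q.:+ (Q.:- b) Q.:* u Q.:+ (Q.:- c) Q.:* v Q.:+ (Q.:- d) Q.:* (u Q.:* v))
       Q.refl u v (base α) (base β) (base γ) (base δ)))

  module _ (u²≈U : u ⊗ u ≈ base U) (v²≈V : v ⊗ v ≈ base V) where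

    nf-⊗ : ∀ {f g} → NF f → NF g → NF (f ⊗ g)
    nf-⊗ (nf α β γ δ f≈) (nf α′ β′ γ′ δ′ g≈) =
      nf (α ⊗ α′ ⊕ U ⊗ (β ⊗ β′) ⊕ V ⊗ (γ ⊗ γ′) ⊕ U ⊗ V ⊗ (δ ⊗ δ′))
         (α ⊗ β′ ⊕ β ⊗ α′ ⊕ V ⊗ (γ ⊗ δ′ ⊕ δ ⊗ γ′))
         (α ⊗ γ′ ⊕ γ ⊗ α′ ⊕ U ⊗ (β ⊗ δ′ ⊕ δ ⊗ β′))
         (α ⊗ δ′ ⊕ δ ⊗ α′ ⊕ β ⊗ γ′ ⊕ γ ⊗ β′)
      (begin
        _ ≈⟨ Q.*-cong f≈ g≈ ⟩
        combination α β γ δ ⊗ combination α′ β′ γ′ δ′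
          ≈⟨ Q.solve 10 (λ u v a b c d a′ b′ c′ d′ →
            (a Q.:+ b Q.:* u Q.:+ c Q.:* v Q.:+ d Q.:* (u Q.:* v)) Q.:*
            (a′ Q.:+ b′ Q.:* u Q.:+ c′ Q.:* v Q.:+ d′ Q.:* (u Q.:* v)) Q.:=
            (a Q.:* a′ Q.:+ u Q.:* u Q.:* (b Q.:* b′) Q.:+ v Q.:* v Q.:* (c Q.:* c′) Q.:+
             u Q.:* u Q.:* (v Q.:* v) Q.:* (d Q.:* d′)) Q.:+
            (a Q.:* b′ Q.:+ b Q.:* a′ Q.:+ v Q.:* v Q.:* (c Q.:* d′ Q.:+ d Q.:* c′)) Q.:* u Q.:+
            (a Q.:* c′ Q.:+ c Q.:* a′ Q.:+ u Q.:* u Q.:* (b Q.:* d′ Q.:+ d Q.:* b′)) Q.:* v Q.:+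
            (a Q.:* d′ Q.:+ d Q.:* a′ Q.:+ b Q.:* c′ Q.:+ c Q.:* b′) Q.:* (u Q.:* v))
           Q.refl u v (base α) (base β) (base γ) (base δ) (base α′) (base β′) (base γ′) (base δ′) ⟩
        _ ≈⟨ Q.+-congʳ (Q.+-cong (Q.+-cong
               (Q.+-cong (Q.+-cong (Q.+-congˡ (Q.*-congʳ u²≈U)) (Q.*-congʳ v²≈V))
                         (Q.*-congʳ (Q.*-cong u²≈U v²≈V)))
               (Q.*-congʳ (Q.+-congˡ (Q.*-congʳ v²≈V))))
               (Q.*-congʳ (Q.+-congˡ (Q.*-congʳ u²≈U)))) ⟩
        _ ∎)
      where open SetoidReasoning Q.setoid

    normalForm : (∀ i → NF (var i)) → ∀ f → NF f
    normalForm vars (con a) = nf-base (con a)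
    normalForm vars (var i) = vars i
    normalForm vars (f ⊕ g) = nf-⊕ (normalForm vars f) (normalForm vars g)
    normalForm vars (f ⊗ g) = nf-⊗ (normalForm vars f) (normalForm vars g)
    normalForm vars (⊝ f)   = nf-⊝ (normalForm vars f)

-- Equations and parametrisation of X′

-- The equations of X′ in an arbitrary ℚ-algebra.  A point is (w, t, x, u, v) with
-- w = 1 / (t² - 1), and y = φ(t) is (t² + 1) w.
module Surface (A : ℚ-Algebra) (n : ℚ) where
  open ℚ-Algebra A

  s : Carrier → Carrier
  s t = t * t - ι 1ℚ

  φ⟨_,_⟩ : Carrier → Carrier → Carrier
  φ⟨ w , t ⟩ = (t * t + ι 1ℚ) * w

  -- The left-hand sides of the equations of X′, for given y in E₁ and E₂.

  E₀ : Carrier → Carrier → Carrier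
  E₀ w t = w * (t * t - ι 1ℚ) - ι 1ℚ

  E₁ E₂ : Carrier → Carrier → Carrier → Carrier
  E₁ x y u = x * y + x * ι 1ℚ + y * ι 1ℚ - ι n * (ι 1ℚ * ι 1ℚ) - u * u
  E₂ x y v = x * y - x * ι 1ℚ - y * ι 1ℚ + ι n * (ι 1ℚ * ι 1ℚ) - v * v

  record OnX′ (w t x u v : Carrier) : Set where
    constructor onX′
    field
      eq₀ : E₀ w t ≈ 0#
      eq₁ : E₁ x φ⟨ w , t ⟩ u ≈ 0#
      eq₂ : E₂ x φ⟨ w , t ⟩ v ≈ 0#

  -- On X′ one has (u + t v) (u - t v) = c.
  c : Carrier → Carrier → Carrier
  c w t = (t * t + ι 1ℚ) * (φ⟨ w , t ⟩ - ι n)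

  -- The solution x of E₂ = 0, because y - 1 = 2 w.
  xOf : Carrier → Carrier → Carrier → Carrier
  xOf w t v = ι ½ * (v * v + (φ⟨ w , t ⟩ - ι n)) * s t

  -- The equations of X′ amount to w (t² - 1) = 1, to the formula for x, and to
  -- the equation of a conic over the t-line which is split by u ± t v.

  onX′-intro : ∀ {w t u v} → E₀ w t ≈ 0# → (u + t * v) * (u - t * v) ≈ c w t →
               OnX′ w t (xOf w t v) u v
  onX′-intro {w} {t} {u} {v} e₀ pq≈c = onX′ e₀
    (combine₂ (ι ½ * z * (t * t + ι 1ℚ)) (- ι 1ℚ)
      (solve 5 (λ w t u v n →
         let y = (t :* t :+ κ 1ℚ) :* w ; z = v :* v :+ (y :- n) ; x = κ ½ :* z :* (t :* t :- κ 1ℚ) in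
         x :* y :+ x :* κ 1ℚ :+ y :* κ 1ℚ :- n :* (κ 1ℚ :* κ 1ℚ) :- u :* u :=
         κ ½ :* z :* (t :* t :+ κ 1ℚ) :* (w :* (t :* t :- κ 1ℚ) :- κ 1ℚ) :+
         (:- κ 1ℚ) :* ((u :+ t :* v) :* (u :- t :* v) :- (t :* t :+ κ 1ℚ) :* (y :- n)))
       refl w t u v (ι n))
      e₀ (≈⇒-≈0 pq≈c))
    (combine₁ (ι ½ * z * (t * t + ι 1ℚ))
      (solve 4 (λ w t v n →
         let y = (t :* t :+ κ 1ℚ) :* w ; z = v :* v :+ (y :- n) ; x = κ ½ :* z :* (t :* t :- κ 1ℚ) in
         x :* y :- x :* κ 1ℚ :- y :* κ 1ℚ :+ n :* (κ 1ℚ :* κ 1ℚ) :- v :* v :=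
         κ ½ :* z :* (t :* t :+ κ 1ℚ) :* (w :* (t :* t :- κ 1ℚ) :- κ 1ℚ))
       refl w t v (ι n))
      e₀)
    where
    z : Carrier
    z = v * v + (φ⟨ w , t ⟩ - ι n)

  module _ {w t x u v} (P : OnX′ w t x u v) where
    open OnX′ P

    onX′-x : x ≈ xOf w t v
    onX′-x = -≈0⇒≈ (combine₂ (- (ι ½ * x * (t * t + ι 1ℚ))) (ι ½ * s t)
      (solve 5 (λ w t x v n →
         let y = (t :* t :+ κ 1ℚ) :* w ; z = v :* v :+ (y :- n) ; s = t :* t :- κ 1ℚ in
         x :- κ ½ :* z :* s :=
         (:- (κ ½ :* x :* (t :* t :+ κ 1ℚ))) :* (w :* s :- κ 1ℚ) :+
         κ ½ :* s :* (x :* y :- x :* κ 1ℚ :- y :* κ 1ℚ :+ n :* (κ 1ℚ :* κ 1ℚ) :- v :* v))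
       refl w t x v (ι n)) eq₀ eq₂)

    onX′-norm : (u + t * v) * (u - t * v) ≈ c w t
    onX′-norm = -≈0⇒≈ (combine₃ (- (x * (t * t + ι 1ℚ))) (- ι 1ℚ) (t * t)
      (solve 6 (λ w t x u v n →
         let y = (t :* t :+ κ 1ℚ) :* w in
         (u :+ t :* v) :* (u :- t :* v) :- (t :* t :+ κ 1ℚ) :* (y :- n) :=
         (:- (x :* (t :* t :+ κ 1ℚ))) :* (w :* (t :* t :- κ 1ℚ) :- κ 1ℚ) :+
         (:- κ 1ℚ) :* (x :* y :+ x :* κ 1ℚ :+ y :* κ 1ℚ :- n :* (κ 1ℚ :* κ 1ℚ) :- u :* u) :+
         t :* t :* (x :* y :- x :* κ 1ℚ :- y :* κ 1ℚ :+ n :* (κ 1ℚ :* κ 1ℚ) :- v :* v))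
       refl w t x u v (ι n)) eq₀ eq₁ eq₂)

  -- The rational parametrisation of X′ by t and p = u + t v.  It is defined where
  -- t p (t² - 1) has an inverse r; then q = c / p is u - t v, and tInv = 1 / t.

  wOf tInvOf qOf uOf vOf xOf′ : Carrier → Carrier → Carrier → Carrier
  wOf r t p = r * t * p
  tInvOf r t p = r * p * s t
  qOf r t p = c (wOf r t p) t * (r * t * s t)
  uOf r t p = ι ½ * (p + qOf r t p)
  vOf r t p = ι ½ * tInvOf r t p * (p - qOf r t p)
  xOf′ r t p = xOf (wOf r t p) t (vOf r t p)

  module _ {r t p} (h : r * (t * p * (t * t - ι 1ℚ)) - ι 1ℚ ≈ 0#) where

    private
      tInv-inverse : t * tInvOf r t p - ι 1ℚ ≈ 0#
      tInv-inverse = trans (solve 3 (λ r t p →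
        t :* (r :* p :* (t :* t :- κ 1ℚ)) :- κ 1ℚ := r :* (t :* p :* (t :* t :- κ 1ℚ)) :- κ 1ℚ)
        refl r t p) h

    u+tv≈p : uOf r t p + t * vOf r t p ≈ p
    u+tv≈p = -≈0⇒≈ (combine₁ (ι ½ * (p - qOf r t p)) (solve 4 (λ t p q i →
      κ ½ :* (p :+ q) :+ t :* (κ ½ :* i :* (p :- q)) :- p :=
      κ ½ :* (p :- q) :* (t :* i :- κ 1ℚ)) refl t p (qOf r t p) (tInvOf r t p)) tInv-inverse)

    u-tv≈q : uOf r t p - t * vOf r t p ≈ qOf r t p
    u-tv≈q = -≈0⇒≈ (combine₁ (- (ι ½ * (p - qOf r t p))) (solve 4 (λ t p q i →
      κ ½ :* (p :+ q) :- t :* (κ ½ :* i :* (p :- q)) :- q :=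
      (:- (κ ½ :* (p :- q))) :* (t :* i :- κ 1ℚ)) refl t p (qOf r t p) (tInvOf r t p)) tInv-inverse)

    onX′-parametrisation : OnX′ (wOf r t p) t (xOf′ r t p) (uOf r t p) (vOf r t p)
    onX′-parametrisation = onX′-intro
      (trans (solve 3 (λ r t p →
        r :* t :* p :* (t :* t :- κ 1ℚ) :- κ 1ℚ := r :* (t :* p :* (t :* t :- κ 1ℚ)) :- κ 1ℚ)
        refl r t p) h)
      (trans (*-cong u+tv≈p u-tv≈q) (-≈0⇒≈ (combine₁ (c (wOf r t p) t)
        (solve 4 (λ r t p c →
          p :* (c :* (r :* t :* (t :* t :- κ 1ℚ))) :- c :=
          c :* (r :* (t :* p :* (t :* t :- κ 1ℚ)) :- κ 1ℚ)) refl r t p (c (wOf r t p) t)) h)))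

  -- Where t (u + t v) has an inverse δ, a point of X′ is recovered from its
  -- parameters.
  module _ {δ w t x u v} (P : OnX′ w t x u v) (h : δ * (t * (u + t * v)) - ι 1ℚ ≈ 0#) where
    open OnX′ P
    private
      p r : Carrier
      p = u + t * v
      r = δ * w

    w-recovered : wOf r t p ≈ w
    w-recovered = -≈0⇒≈ (combine₁ w (solve 4 (λ δ w t p →
      δ :* w :* t :* p :- w := w :* (δ :* (t :* p) :- κ 1ℚ)) refl δ w t p) h)

    δ-recovered : r * s t ≈ δ
    δ-recovered = -≈0⇒≈ (combine₁ δ (solve 3 (λ δ w t →
      δ :* w :* (t :* t :- κ 1ℚ) :- δ := δ :* (w :* (t :* t :- κ 1ℚ) :- κ 1ℚ)) refl δ w t) eq₀)

    parameter-inverse : r * (t * p * (t * t - ι 1ℚ)) - ι 1ℚ ≈ 0#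
    parameter-inverse = combine₂ (w * s t) (ι 1ℚ) (solve 4 (λ δ w t p →
      let s = t :* t :- κ 1ℚ in
      δ :* w :* (t :* p :* s) :- κ 1ℚ :=
      w :* s :* (δ :* (t :* p) :- κ 1ℚ) :+ κ 1ℚ :* (w :* s :- κ 1ℚ)) refl δ w t p) h eq₀

    private
      c-recovered : c (wOf r t p) t ≈ p * (u - t * v)
      c-recovered = trans (*-congˡ (+-congʳ (*-congˡ w-recovered))) (sym (onX′-norm P))

      q-recovered : qOf r t p ≈ u - t * v
      q-recovered = trans (*-congʳ c-recovered) (-≈0⇒≈ (combine₁ (u - t * v)
        (solve 5 (λ δ w t p q →
          let s = t :* t :- κ 1ℚ in
          p :* q :* (δ :* w :* t :* s) :- q := q :* (δ :* w :* (t :* p :* s) :- κ 1ℚ))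
         refl δ w t p (u - t * v)) parameter-inverse))

    u-recovered : uOf r t p ≈ u
    u-recovered = trans (*-congˡ (+-congˡ q-recovered)) (solve 3 (λ t u v →
      κ ½ :* (u :+ t :* v :+ (u :- t :* v)) := u) refl t u v)

    v-recovered : vOf r t p ≈ v
    v-recovered = trans (*-congˡ (+-congˡ (-‿cong q-recovered))) (-≈0⇒≈ (combine₁ v
      (solve 5 (λ r t u v p →
        let s = t :* t :- κ 1ℚ in
        κ ½ :* (r :* p :* s) :* (u :+ t :* v :- (u :- t :* v)) :- v :=
        v :* (r :* (t :* p :* s) :- κ 1ℚ)) refl r t u v p) parameter-inverse))

    x-recovered : xOf′ r t p ≈ x
    x-recovered = trans (*-congʳ (*-congˡ (+-cong (*-cong v-recovered v-recovered)
      (+-congʳ (*-congˡ w-recovered))))) (sym (onX′-x P))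

-- Density of the points of X′

-- The points of X′ over K project densely to the (x, t)-plane and to the
-- (x, y)-plane.
module Density (K : Extension) (n : ℚ) where
  open ExtensionFacts K
  open Surface (extensionAlgebra K) n

  horner-cong : ∀ cs {s s′} → s ≈ s′ → horner cs s ≈ horner cs s′
  horner-cong []       e = refl
  horner-cong (c ∷ cs) e = +-congˡ (*-cong e (horner-cong cs e))

  ι1≉0 : ¬ ι 1ℚ ≈ 0#
  ι1≉0 = ι-≉0 λ ()

  quadratic : ∀ a b → ¬ b ≈ 0# ⊎ ¬ a ≈ 0# → Cofinitely (λ s → ¬ a + b * (s * s) ≈ 0#)
  quadratic a b nz = cofinitely-map (λ s h≉0 q≈0 → h≉0 (trans (horner-value s) q≈0))
    (horner-≉0 (nonZero nz))
    where
    cs : List Carrier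
    cs = a ∷ ι 0ℚ ∷ b ∷ []
    nonZero : ¬ b ≈ 0# ⊎ ¬ a ≈ 0# → NonZero cs
    nonZero (inj₁ b≉0) = there (there (here b≉0))
    nonZero (inj₂ a≉0) = here a≉0
    horner-value : ∀ s → horner cs s ≈ a + b * (s * s)
    horner-value s = trans
      (+-congˡ (*-congˡ (+-congˡ (*-congˡ (trans (+-congˡ (zeroʳ s)) (+-identityʳ b))))))
      (solve 3 (λ a b s → a :+ s :* (κ 0ℚ :+ s :* b) := a :+ b :* (s :* s)) refl a b s)

  -- φ takes each value r finitely often: t² + 1 - r (t² - 1) is a nonzero
  -- polynomial, since its coefficients 1 + r and 1 - r have sum 2.

  φ-numerator : ∀ r → Cofinitely (λ t → ¬ t * t + ι 1ℚ - r * s t ≈ 0#)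
  φ-numerator r = cofinitely-map (λ t q≉0 e → q≉0 (trans (sym (solve 2 (λ r t →
      t :* t :+ κ 1ℚ :- r :* (t :* t :- κ 1ℚ) := κ 1ℚ :+ r :+ (κ 1ℚ :- r) :* (t :* t)) refl r t)) e))
    (quadratic (ι 1ℚ + r) (ι 1ℚ - r) nz)
    where
    nz : ¬ ι 1ℚ - r ≈ 0# ⊎ ¬ ι 1ℚ + r ≈ 0#
    nz with (ι 1ℚ - r) ≈? 0# | (ι 1ℚ + r) ≈? 0#
    ... | no d≉0 | _      = inj₁ d≉0
    ... | yes _  | no σ≉0 = inj₂ σ≉0
    ... | yes d≈0 | yes σ≈0 = contradiction
      (combine₂ (ι ½) (ι ½) (solve 1 (λ r → κ 1ℚ := κ ½ :* (κ 1ℚ :- r) :+ κ ½ :* (κ 1ℚ :+ r)) refl r)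
        d≈0 σ≈0) ι1≉0

  φ-fibre : ∀ {w t} r → E₀ w t ≈ 0# → ¬ t * t + ι 1ℚ - r * s t ≈ 0# → ¬ φ⟨ w , t ⟩ - r ≈ 0#
  φ-fibre {w} {t} r e₀ q≉0 φ≈r = q≉0 (combine₂ (s t) (- (t * t + ι 1ℚ)) (solve 3 (λ w t r →
      let s = t :* t :- κ 1ℚ in
      t :* t :+ κ 1ℚ :- r :* s :=
      s :* ((t :* t :+ κ 1ℚ) :* w :- r) :+ (:- (t :* t :+ κ 1ℚ)) :* (w :* s :- κ 1ℚ))
    refl w t r) φ≈r e₀)

  inverse-unique : ∀ {w w′ t} → E₀ w t ≈ 0# → E₀ w′ t ≈ 0# → w ≈ w′
  inverse-unique {w} {w′} {t} e e′ = -≈0⇒≈ (combine₂ w′ (- w) (solve 3 (λ w w′ t →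
      let s = t :* t :- κ 1ℚ in
      w :- w′ := w′ :* (w :* s :- κ 1ℚ) :+ (:- w) :* (w′ :* s :- κ 1ℚ)) refl w w′ t) e e′)

  φ-cong : ∀ {w w′} t → w ≈ w′ → φ⟨ w , t ⟩ ≈ φ⟨ w′ , t ⟩
  φ-cong t = *-congˡ

  onX′-resp : ∀ {w w′ t x u v} → w ≈ w′ → OnX′ w t x u v → OnX′ w′ t x u v
  onX′-resp {w} {w′} {t} {x} {u} {v} w≈w′ (onX′ e₀ e₁ e₂) = onX′
    (trans (+-congʳ (*-congʳ (sym w≈w′))) e₀)
    (trans (+-congʳ (+-congʳ (+-cong (+-congʳ (*-congˡ y)) (*-congʳ y)))) e₁)
    (trans (+-congʳ (+-congʳ (+-cong (+-congʳ (*-congˡ y)) (-‿cong (*-congʳ y))))) e₂)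
    where
    y : φ⟨ w′ , t ⟩ ≈ φ⟨ w , t ⟩
    y = φ-cong t (sym w≈w′)

  s-≉0 : Cofinitely (λ t → ¬ s t ≈ 0#)
  s-≉0 = cofinitely-map
    (λ t h e → h (trans (solve 1 (λ t → (:- κ 1ℚ) :+ κ 1ℚ :* (t :* t) := t :* t :- κ 1ℚ) refl t) e))
    (quadratic (- ι 1ℚ) (ι 1ℚ) (inj₁ ι1≉0))

  t²+1-≉0 : Cofinitely (λ t → ¬ t * t + ι 1ℚ ≈ 0#)
  t²+1-≉0 = cofinitely-map
    (λ t h e → h (trans (solve 1 (λ t → κ 1ℚ :+ κ 1ℚ :* (t :* t) := t :* t :+ κ 1ℚ) refl t) e))
    (quadratic (ι 1ℚ) (ι 1ℚ) (inj₁ ι1≉0))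

  s-inverse : ∀ {t} → ¬ s t ≈ 0# → ∃[ w ] E₀ w t ≈ 0#
  s-inverse s≉0 = let (w , ws≈1) = invertible _ s≉0 in w , ≈⇒-≈0 (trans ws≈1 (sym 1#-homo))

  horner-quartic : ∀ a b m d e s →
    horner (a ∷ b ∷ m ∷ d ∷ e ∷ []) s ≈ a + s * (b + s * (m + s * (d + s * e)))
  horner-quartic a b m d e s = +-congˡ (*-congˡ (+-congˡ (*-congˡ (+-congˡ (*-congˡ
    (+-congˡ (*-congˡ (trans (+-congˡ (zeroʳ s)) (+-identityʳ e)))))))))

  horner-middle : ∀ a b {m m′} cs s → m ≈ m′ → horner (a ∷ b ∷ m ∷ cs) s ≈ horner (a ∷ b ∷ m′ ∷ cs) s
  horner-middle a b cs s e = +-congˡ (*-congˡ (+-congˡ (*-congˡ (+-congʳ e))))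

  -- For fixed t and x, the values of p = u + t v at the points (w, t, x, u, v)
  -- of X′ are among the roots of a quartic polynomial: p² - c = 2 t v p, where
  -- v² = 2 w x - y + n, so that (p² - c)² = 4 t² p² (2 w x - y + n).
  module _ (w t : Carrier) where
    private
      4′ 2′ : ℚ
      4′ = + 4 ℚ./ 1
      2′ = + 2 ℚ./ 1

    quarticMiddle : Carrier → Carrier
    quarticMiddle x = - (ι 2′ * c w t) - ι 4′ * (t * t) * (ι 2′ * w * x - φ⟨ w , t ⟩ + ι n)

    quarticMiddle-cong : ∀ {x x′} → x ≈ x′ → quarticMiddle x ≈ quarticMiddle x′
    quarticMiddle-cong e = +-congˡ (-‿cong (*-congˡ (+-congʳ (+-congʳ (*-congˡ e)))))

    quartic : Carrier → List Carrier
    quartic x = c w t * c w t ∷ ι 0ℚ ∷ quarticMiddle x ∷ ι 0ℚ ∷ ι 1ℚ ∷ []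

    quartic-root : ∀ {x u v} → OnX′ w t x u v → horner (quartic x) (u + t * v) ≈ 0#
    quartic-root {x} {u} {v} P = trans (horner-quartic _ _ _ _ _ _)
      (combine₃ (ι 4′ * t * v * p + F) (- (ι 4′ * (t * t) * (p * p))) (ι 4′ * (t * t) * (p * p) * x)
        (solve 6 (λ w t x u v n →
           let s = t :* t :- κ 1ℚ
               y = (t :* t :+ κ 1ℚ) :* w
               c = (t :* t :+ κ 1ℚ) :* (y :- n)
               p = u :+ t :* v
               F = p :* (u :- t :* v) :- c
           in
           c :* c :+ p :* (κ 0ℚ :+ p :* (((:- (κ 2′ :* c)) :- κ 4′ :* (t :* t) :* (κ 2′ :* w :* x :- y :+ n))
             :+ p :* (κ 0ℚ :+ p :* κ 1ℚ))) :=
           (κ 4′ :* t :* v :* p :+ F) :* F :+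
           (:- (κ 4′ :* (t :* t) :* (p :* p))) :*
             (x :* y :- x :* κ 1ℚ :- y :* κ 1ℚ :+ n :* (κ 1ℚ :* κ 1ℚ) :- v :* v) :+
           κ 4′ :* (t :* t) :* (p :* p) :* x :* (w :* s :- κ 1ℚ))
         refl w t x u v (ι n))
        (≈⇒-≈0 (onX′-norm P)) (OnX′.eq₂ P) (OnX′.eq₀ P))
      where
      p F : Carrier
      p = u + t * v
      F = p * (u - t * v) - c w t

  -- A point of X′, with all relevant quantities nonzero, over a point of the
  -- (x, t)-plane with property Q.
  record GenericPoint (Q : Carrier → Carrier → Set) : Set where
    field
      {w t x u v} : Carrier
      onX         : OnX′ w t x u v
      t≉0         : ¬ t ≈ 0#
      u≉0         : ¬ u ≈ 0#
      v≉0         : ¬ v ≈ 0#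
      c≉0         : ¬ c w t ≈ 0#
      satisfies   : Q x t

  genericPoint : ∀ {Q} → Cofinitely (λ t → Cofinitely (λ x → Q x t)) → ¬ ¬ GenericPoint Q
  genericPoint {Q} genQ k = cofinitely-∃
    (cofinitely-∩ genQ (cofinitely-∩ (cofinitely-≉ 0#)
      (cofinitely-∩ s-≉0 (cofinitely-∩ t²+1-≉0 (φ-numerator (ι n))))))
    λ (t , Qt , t≉0 , s≉0 , t²+1≉0 , φ≉n) → atParameter Qt t≉0 s≉0 t²+1≉0 φ≉n
    where
    -- For fixed t, the points of the fibre correspond to p ≠ 0, and each value of
    -- x is taken for finitely many p only.
    module _ {t} (Qt : Cofinitely (λ x → Q x t)) (t≉0 : ¬ t ≈ 0#) (s≉0 : ¬ s t ≈ 0#)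
             (t²+1≉0 : ¬ t * t + ι 1ℚ ≈ 0#) (φ≉n : ¬ t * t + ι 1ℚ - ι n * s t ≈ 0#) where

      w : Carrier
      w = proj₁ (s-inverse s≉0)

      e₀ : E₀ w t ≈ 0#
      e₀ = proj₂ (s-inverse s≉0)

      c≉0 : ¬ c w t ≈ 0#
      c≉0 = *-≉0 t²+1≉0 (φ-fibre (ι n) e₀ φ≉n)

      -- x is the first coordinate of a point with parameters t and p.
      T : Carrier → Carrier → Set
      T p x = ∃[ u ] ∃[ v ] OnX′ w t x u v × u + t * v ≈ p

      finiteFibres : ∀ r → Cofinitely (λ p → ∀ x → T p x → ¬ x ≈ r)
      finiteFibres r = cofinitely-map
        (λ { p h≉0 x (u , v , P , u+tv≈p) x≈r → h≉0 (trans
             (horner-≈ x≈r p)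
             (trans (horner-cong (quartic w t x) (sym u+tv≈p)) (quartic-root w t P))) })
        (horner-≉0 {quartic w t r} (there (there (there (there (here ι1≉0))))))
        where
        horner-≈ : ∀ {x r} → x ≈ r → ∀ p → horner (quartic w t r) p ≈ horner (quartic w t x) p
        horner-≈ x≈r p = horner-middle _ _ (ι 0ℚ ∷ ι 1ℚ ∷ []) p (quarticMiddle-cong w t (sym x≈r))

      atParameter : ⊥
      atParameter = cofinitely-∃
        (cofinitely-∩ (cofinitely-preimage {λ x → Q x t} T finiteFibres Qt) (cofinitely-∩ (cofinitely-≉ 0#)
          (cofinitely-∩ (quadratic (c w t) (ι 1ℚ) (inj₁ ι1≉0))
                        (quadratic (- c w t) (ι 1ℚ) (inj₁ ι1≉0)))))
        λ (p , Qp , p≉0 , p²+c≉0 , p²-c≉0) →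
        let (r , re≈1) = invertible (t * p * s t) (*-≉0 (*-≉0 t≉0 p≉0) s≉0) in
        k (point r p (≈⇒-≈0 (trans re≈1 (sym 1#-homo))) Qp p²+c≉0 p²-c≉0)
        where
        module _ r p (re-1≈0 : r * (t * p * s t) - ι 1ℚ ≈ 0#) (Qp : ∀ x → T p x → Q x t)
                 (p²+c≉0 : ¬ c w t + ι 1ℚ * (p * p) ≈ 0#)
                 (p²-c≉0 : ¬ - c w t + ι 1ℚ * (p * p) ≈ 0#) where
          x u v : Carrier
          x = xOf′ r t p
          u = uOf r t p
          v = vOf r t p

          P : OnX′ w t x u v
          P = onX′-resp (inverse-unique (OnX′.eq₀ P₀) e₀) P₀
            where
            P₀ : OnX′ (wOf r t p) t x u v
            P₀ = onX′-parametrisation re-1≈0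

          sum : u + t * v ≈ p
          sum = u+tv≈p re-1≈0

          norm : c w t - p * (u - t * v) ≈ 0#
          norm = ≈⇒-≈0 (trans (sym (onX′-norm P)) (*-congʳ sum))

          u≉0 : ¬ u ≈ 0#
          u≉0 u≈0 = p²+c≉0 (combine₃ (ι 1ℚ) (- p) (ι (+ 2 ℚ./ 1) * p)
            (solve 5 (λ t p u v c →
              c :+ κ 1ℚ :* (p :* p) := κ 1ℚ :* (c :- p :* (u :- t :* v)) :+
              (:- p) :* (u :+ t :* v :- p) :+ κ (+ 2 ℚ./ 1) :* p :* u)
             refl t p u v (c w t)) norm (≈⇒-≈0 sum) u≈0)

          v≉0 : ¬ v ≈ 0#
          v≉0 v≈0 = p²-c≉0 (combine₃ (- ι 1ℚ) (- p) (ι (+ 2 ℚ./ 1) * p * t)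
            (solve 5 (λ t p u v c →
              (:- c) :+ κ 1ℚ :* (p :* p) := (:- κ 1ℚ) :* (c :- p :* (u :- t :* v)) :+
              (:- p) :* (u :+ t :* v :- p) :+ κ (+ 2 ℚ./ 1) :* p :* t :* v)
             refl t p u v (c w t)) norm (≈⇒-≈0 sum) v≈0)

          point : GenericPoint Q
          point = record
            { onX = P ; t≉0 = t≉0 ; u≉0 = u≉0 ; v≉0 = v≉0 ; c≉0 = c≉0
            ; satisfies = Qp x (u , v , P , sum) }

  -- The analogue for a property of (x, y).  The inverse w of t² - 1 is quantified
  -- again in order to express the property as one of (x, t).
  genericPoint-xy : ∀ {Q : Carrier → Carrier → Set} → Cofinitely (λ y → Cofinitely (λ x → Q x y)) →
    ¬ ¬ GenericPoint (λ x t → ∃[ w ] E₀ w t ≈ 0# × Q x φ⟨ w , t ⟩)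
  genericPoint-xy {Q} genQ = genericPoint
    (cofinitely-map lift (cofinitely-∩
      (cofinitely-preimage {λ y → Cofinitely (λ x → Q x y)} T finiteFibres genQ) s-≉0))
    where
    T : Carrier → Carrier → Set
    T t y = ∃[ w ] E₀ w t ≈ 0# × y ≡ φ⟨ w , t ⟩
    finiteFibres : ∀ r → Cofinitely (λ t → ∀ y → T t y → ¬ y ≈ r)
    finiteFibres r = cofinitely-map
      (λ { t q≉0 y (w , e₀ , ≡.refl) y≈r → φ-fibre r e₀ q≉0 (≈⇒-≈0 y≈r) })
      (φ-numerator r)
    lift : ∀ t → (∀ y → T t y → Cofinitely (λ x → Q x y)) × ¬ s t ≈ 0# →
           Cofinitely (λ x → ∃[ w ] E₀ w t ≈ 0# × Q x φ⟨ w , t ⟩)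
    lift t (Qφ , s≉0) with s-inverse s≉0
    ... | w , e₀ = cofinitely-map (λ x q → w , e₀ , q) (Qφ _ (w , e₀ , ≡.refl))

-- Functions vanishing at many points

module SignChange (A : ℚ-Algebra) where
  open ℚ-Algebra A

  private
    ¼ : ℚ
    ¼ = + 1 ℚ./ 4

  -- If a combination of 1, u, v and u v vanishes for all choices of the
  -- signs of u and v, then all its terms vanish.
  module _ {α β γ δ u v : Carrier}
    (pp : α + β * u + γ * v + δ * (u * v) ≈ 0#)
    (mp : α + β * (- u) + γ * v + δ * ((- u) * v) ≈ 0#)
    (pm : α + β * u + γ * (- v) + δ * (u * (- v)) ≈ 0#)
    (mm : α + β * (- u) + γ * (- v) + δ * ((- u) * (- v)) ≈ 0#)
    where

    private
      combine₄ : ∀ {a} k₁ k₂ k₃ k₄ →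
        a ≈ k₁ * (α + β * u + γ * v + δ * (u * v)) + k₂ * (α + β * (- u) + γ * v + δ * ((- u) * v)) +
            k₃ * (α + β * u + γ * (- v) + δ * (u * (- v))) +
            k₄ * (α + β * (- u) + γ * (- v) + δ * ((- u) * (- v))) → a ≈ 0#
      combine₄ k₁ k₂ k₃ k₄ a≈ =
        trans a≈ (trans (+-cong (combine₃ k₁ k₂ k₃ refl pp mp pm) (combine₁ k₄ refl mm))
                        (+-identityˡ 0#))

    α-vanishes : α ≈ 0#
    α-vanishes = combine₄ (ι ¼) (ι ¼) (ι ¼) (ι ¼) (solve 6 (λ α β γ δ u v → α :=
      κ ¼ :* (α :+ β :* u :+ γ :* v :+ δ :* (u :* v)) :+
      κ ¼ :* (α :+ β :* (:- u) :+ γ :* v :+ δ :* ((:- u) :* v)) :+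
      κ ¼ :* (α :+ β :* u :+ γ :* (:- v) :+ δ :* (u :* (:- v))) :+
      κ ¼ :* (α :+ β :* (:- u) :+ γ :* (:- v) :+ δ :* ((:- u) :* (:- v)))) refl α β γ δ u v)

    β-vanishes : β * u ≈ 0#
    β-vanishes = combine₄ (ι ¼) (- ι ¼) (ι ¼) (- ι ¼) (solve 6 (λ α β γ δ u v → β :* u :=
      κ ¼ :* (α :+ β :* u :+ γ :* v :+ δ :* (u :* v)) :+
      (:- κ ¼) :* (α :+ β :* (:- u) :+ γ :* v :+ δ :* ((:- u) :* v)) :+
      κ ¼ :* (α :+ β :* u :+ γ :* (:- v) :+ δ :* (u :* (:- v))) :+
      (:- κ ¼) :* (α :+ β :* (:- u) :+ γ :* (:- v) :+ δ :* ((:- u) :* (:- v)))) refl α β γ δ u v)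

    γ-vanishes : γ * v ≈ 0#
    γ-vanishes = combine₄ (ι ¼) (ι ¼) (- ι ¼) (- ι ¼) (solve 6 (λ α β γ δ u v → γ :* v :=
      κ ¼ :* (α :+ β :* u :+ γ :* v :+ δ :* (u :* v)) :+
      κ ¼ :* (α :+ β :* (:- u) :+ γ :* v :+ δ :* ((:- u) :* v)) :+
      (:- κ ¼) :* (α :+ β :* u :+ γ :* (:- v) :+ δ :* (u :* (:- v))) :+
      (:- κ ¼) :* (α :+ β :* (:- u) :+ γ :* (:- v) :+ δ :* ((:- u) :* (:- v)))) refl α β γ δ u v)

    δ-vanishes : δ * (u * v) ≈ 0#
    δ-vanishes = combine₄ (ι ¼) (- ι ¼) (- ι ¼) (ι ¼) (solve 6 (λ α β γ δ u v → δ :* (u :* v) :=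
      κ ¼ :* (α :+ β :* u :+ γ :* v :+ δ :* (u :* v)) :+
      (:- κ ¼) :* (α :+ β :* (:- u) :+ γ :* v :+ δ :* ((:- u) :* v)) :+
      (:- κ ¼) :* (α :+ β :* u :+ γ :* (:- v) :+ δ :* (u :* (:- v))) :+
      κ ¼ :* (α :+ β :* (:- u) :+ γ :* (:- v) :+ δ :* ((:- u) :* (:- v)))) refl α β γ δ u v)

-- In the situation of NormalForm, let b₀ be the inverse of a polynomial e in b₁
-- and b₂.  A function vanishes if it has zeros, closed under sign changes, over
-- a dense set of points of the (b₁, b₂)-plane: by the sign changes all four
-- coefficients of its normal form vanish there.
module VanishingCriterion (K : Extension) {n c} (E : Vector (Poly (Extension.Carrier K) n) c)
  (b₀ : Poly (Extension.Carrier K) n) (b : Vector (Poly (Extension.Carrier K) n) 2)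
  (u v : Poly (Extension.Carrier K) n) (U V : Poly (Extension.Carrier K) 3)
  (e : Poly (Extension.Carrier K) 2)
  where
  open ExtensionFacts K
  open Fractions K
  open NormalForm K E (b₀ Vec.∷ b) u v U V
  open SignChange (extensionAlgebra K)
  private module Q = ℚ-Algebra (quotientAlgebra (extensionAlgebra K) E)

  -- A zero of f on the scheme defined by E, with prescribed coordinates.
  record Zero (f : Poly Carrier n) (r : Carrier) (ρ : Vector Carrier 2) (u₀ v₀ : Carrier) : Set where
    field
      point     : Vector Carrier n
      solution  : ∀ i → value point (E i) ≈ 0#
      base-at   : ∀ i → value point ((b₀ Vec.∷ b) i) ≈ (r Vec.∷ ρ) i
      u-at      : value point u ≈ u₀
      v-at      : value point v ≈ v₀
      zero-at   : value point f ≈ 0#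

  -- A family of zeros closed under the sign changes of u and v, over a point ρ
  -- with property Q.
  record Zeros (f : Poly Carrier n) (Q : Vector Carrier 2 → Set) : Set where
    field
      {r u₀ v₀} : Carrier
      {ρ}       : Vector Carrier 2
      inverse   : r * value ρ e ≈ 1#
      u₀≉0      : ¬ u₀ ≈ 0#
      v₀≉0      : ¬ v₀ ≈ 0#
      satisfies : Q ρ
      pp        : Zero f r ρ u₀ v₀
      mp        : Zero f r ρ (- u₀) v₀
      pm        : Zero f r ρ u₀ (- v₀)
      mm        : Zero f r ρ (- u₀) (- v₀)

  module _ (inverse : b₀ ⊗ substitute rawRing id b e Q.≈ Q.1#) where

    base-vanishes : ∀ α → Vanishes e α → base α Q.≈ Q.0#
    base-vanishes α van = Q.trans
      (Q.sym (Q.≡⇒≈ (eval-quotient commutativeRing id E α)))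
      (vanishes van Q.commutativeRing (con-homo E) b₀ b
        (Q.trans (Q.*-congˡ (Q.≡⇒≈ (eval-quotient commutativeRing id E e))) inverse))

    module _ {f} (N : NF f) (dense : ∀ Q → Generically 2 Q → ¬ ¬ Zeros f Q) where
      open NF N

      private
        zero⇒combination : ∀ {r ρ u₀ v₀} → Zero f r ρ u₀ v₀ →
          value (r Vec.∷ ρ) α + value (r Vec.∷ ρ) β * u₀ + value (r Vec.∷ ρ) γ * v₀ +
          value (r Vec.∷ ρ) δ * (u₀ * v₀) ≈ 0#
        zero⇒combination {r} {ρ} z = trans
          (sym (trans (value-sound point solution correct)
            (+-cong (+-cong (+-cong (at α) (*-cong (at β) u-at)) (*-cong (at γ) v-at))
                    (*-cong (at δ) (*-cong u-at v-at)))))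
          zero-at
          where
          open Zero z
          at : ∀ ε → value point (base ε) ≈ value (r Vec.∷ ρ) ε
          at ε = trans (≡⇒≈ (eval-substitute rawRing rawRing id id point (b₀ Vec.∷ b) ε))
                       (eval-cong commutativeRing id base-at ε)

        module _ {Q} (z : Zeros f Q) where
          open Zeros z
          values : Poly Carrier 3 → Carrier
          values = value (r Vec.∷ ρ)

          α≈0 : values α ≈ 0#
          α≈0 = α-vanishes (zero⇒combination pp) (zero⇒combination mp)
                           (zero⇒combination pm) (zero⇒combination mm)

          β≈0 : values β ≈ 0#
          β≈0 = *-zero-cancel u₀≉0 (trans (*-comm _ _)
            (β-vanishes (zero⇒combination pp) (zero⇒combination mp)
                        (zero⇒combination pm) (zero⇒combination mm)))

          γ≈0 : values γ ≈ 0#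
          γ≈0 = *-zero-cancel v₀≉0 (trans (*-comm _ _)
            (γ-vanishes (zero⇒combination pp) (zero⇒combination mp)
                        (zero⇒combination pm) (zero⇒combination mm)))

          δ≈0 : values δ ≈ 0#
          δ≈0 = *-zero-cancel (*-≉0 u₀≉0 v₀≉0) (trans (*-comm _ _)
            (δ-vanishes (zero⇒combination pp) (zero⇒combination mp)
                        (zero⇒combination pm) (zero⇒combination mm)))

        coefficient : ∀ ε → (∀ {Q} (z : Zeros f Q) → value (Zeros.r z Vec.∷ Zeros.ρ z) ε ≈ 0#) →
                      base ε Q.≈ Q.0#
        coefficient ε ε≈0 with vanishes-or-generically-nonzero e ε
        ... | inj₁ van = base-vanishes ε van
        ... | inj₂ gen = ⊥-elim (dense (λ ρ → ∀ r → r * value ρ e ≈ 1# → ¬ value (r Vec.∷ ρ) ε ≈ 0#) gen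
              λ z → Zeros.satisfies z _ (Zeros.inverse z) (ε≈0 z))

      vanishing : f Q.≈ Q.0#
      vanishing = Q.trans correct (Q.trans
        (Q.+-cong (Q.+-cong (Q.+-cong
          (coefficient α α≈0)
          (Q.trans (Q.*-congʳ (coefficient β β≈0)) (Q.zeroˡ _)))
          (Q.trans (Q.*-congʳ (coefficient γ γ≈0)) (Q.zeroˡ _)))
          (Q.trans (Q.*-congʳ (coefficient δ δ≈0)) (Q.zeroˡ _)))
        (Q.trans (Q.+-identityʳ _) (Q.trans (Q.+-identityʳ _) (Q.+-identityʳ _))))

-- X′ is geometrically integral

-- The scheme X′ over an extension K.
module SurfacePoints (K : Extension) (n : ℚ) where
  open ExtensionFacts K
  open Surface (extensionAlgebra K) n
  open Density K n

  onX′-negate-u : ∀ {w t x u v} → OnX′ w t x u v → OnX′ w t x (- u) v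
  onX′-negate-u {u = u} (onX′ e₀ e₁ e₂) = onX′ e₀
    (trans (+-congˡ (-‿cong (solve 1 (λ u → (:- u) :* (:- u) := u :* u) refl u))) e₁) e₂

  onX′-negate-v : ∀ {w t x u v} → OnX′ w t x u v → OnX′ w t x u (- v)
  onX′-negate-v {v = v} (onX′ e₀ e₁ e₂) = onX′ e₀ e₁
    (trans (+-congˡ (-‿cong (solve 1 (λ u → (:- u) :* (:- u) := u :* u) refl v))) e₂)

  -- The parametrisation covers the points where t and c do not vanish.
  chartDenominator-≉0 : ∀ {w t x u v} → OnX′ w t x u v → ¬ t ≈ 0# → ¬ c w t ≈ 0# →
                        ¬ t * (u + t * v) ≈ 0#
  chartDenominator-≉0 P t≉0 c≉0 = *-≉0 t≉0 λ p≈0 →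
    c≉0 (trans (sym (onX′-norm P)) (trans (*-congʳ p≈0) (zeroˡ _)))

  -- The equations of X′ with coefficients in K.
  X′Equations : Vector (Poly Carrier 5) 3
  X′Equations = substitute rawRing ι var ∘ Affine.equations (X′ n)

  point′ : (w t x u v : Carrier) → Vector Carrier 5
  point′ w t x u v = w Vec.∷ t Vec.∷ x Vec.∷ u Vec.∷ v Vec.∷ Vec.[]

  onX′⇒solution : ∀ {w t x u v} → OnX′ w t x u v →
                  ∀ i → value (point′ w t x u v) (X′Equations i) ≈ 0#
  onX′⇒solution (onX′ e₀ e₁ e₂) 0F = e₀
  onX′⇒solution (onX′ e₀ e₁ e₂) 1F = e₁
  onX′⇒solution (onX′ e₀ e₁ e₂) 2F = e₂

  -- The ring of functions on X′ over K.
  module O = ℚ-Algebra (quotientAlgebra (extensionAlgebra K) X′Equations)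

  private
    τ²-1 : Poly Carrier 2
    τ²-1 = var 1F ⊗ var 1F ⊖ con (ι 1ℚ)

    -- The squares of u and v as polynomials in (w, x, t).
    u² v² : Poly Carrier 3
    u² = x ⊗ y ⊕ x ⊗ con (ι 1ℚ) ⊕ y ⊗ con (ι 1ℚ) ⊖ con (ι n) ⊗ (con (ι 1ℚ) ⊗ con (ι 1ℚ))
      where
      x y : Poly Carrier 3
      x = var 1F
      y = (var 2F ⊗ var 2F ⊕ con (ι 1ℚ)) ⊗ var 0F
    v² = x ⊗ y ⊖ x ⊗ con (ι 1ℚ) ⊖ y ⊗ con (ι 1ℚ) ⊕ con (ι n) ⊗ (con (ι 1ℚ) ⊗ con (ι 1ℚ))
      where
      x y : Poly Carrier 3
      x = var 1F
      y = (var 2F ⊗ var 2F ⊕ con (ι 1ℚ)) ⊗ var 0F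

    b : Vector (Poly Carrier 5) 2
    b = var 2F Vec.∷ var 1F Vec.∷ Vec.[]

    module Criterion = VanishingCriterion K X′Equations (var 0F) b (var 3F) (var 4F) u² v² τ²-1
    module N = NormalForm K X′Equations (var 0F Vec.∷ b) (var 3F) (var 4F) u² v²

    variables : ∀ i → N.NF (var i)
    variables 0F = N.nf-base (var 0F)
    variables 1F = N.nf-base (var 2F)
    variables 2F = N.nf-base (var 1F)
    variables 3F = N.nf-u
    variables 4F = N.nf-v

  -- A function vanishing on the points of X′ with t (u + t v) ≠ 0 vanishes.
  X′-vanishing : ∀ f →
    (∀ {w t x u v} → OnX′ w t x u v → ¬ t * (u + t * v) ≈ 0# → value (point′ w t x u v) f ≈ 0#) →
    f O.≈ O.0#
  X′-vanishing f zeros = Criterion.vanishing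
    (O.trans (O.-≈0⇒≈ (relation 0F)) (con-cong 1#-homo))
    (N.normalForm (O.sym (O.-≈0⇒≈ (relation 1F))) (O.sym (O.-≈0⇒≈ (relation 2F))) variables f)
    dense
    where
    zero-at : ∀ {w t x u v} → OnX′ w t x u v → ¬ t ≈ 0# → ¬ c w t ≈ 0# →
              Criterion.Zero f w (x Vec.∷ t Vec.∷ Vec.[]) u v
    zero-at {w} {t} {x} {u} {v} P t≉0 c≉0 = record
      { point = point′ w t x u v
      ; solution = onX′⇒solution P
      ; base-at = λ { 0F → refl ; 1F → refl ; 2F → refl }
      ; u-at = refl
      ; v-at = refl
      ; zero-at = zeros P (chartDenominator-≉0 P t≉0 c≉0) }

    dense : ∀ Q → Generically 2 Q → ¬ ¬ Criterion.Zeros f Q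
    dense Q gen k = genericPoint gen λ G → let open GenericPoint G in k record
      { inverse = trans (-≈0⇒≈ (OnX′.eq₀ onX)) 1#-homo
      ; u₀≉0 = u≉0
      ; v₀≉0 = v≉0
      ; satisfies = satisfies
      ; pp = zero-at onX t≉0 c≉0
      ; mp = zero-at (onX′-negate-u onX) t≉0 c≉0
      ; pm = zero-at (onX′-negate-v onX) t≉0 c≉0
      ; mm = zero-at (onX′-negate-u (onX′-negate-v onX)) t≉0 c≉0 }

  private
    module Param = Surface (quotientAlgebra (extensionAlgebra K) {n = 3} Vec.[]) n

    -- The plane has coordinates (p, t).
    denominator′ : Poly Carrier 2
    denominator′ = var 1F ⊗ var 0F ⊗ (var 1F ⊗ var 1F ⊖ con (ι 1ℚ))

    -- The rational parametrisation, by polynomials in (r, p, t).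
    param : Vector (Poly Carrier 3) 5
    param = Param.wOf r t p Vec.∷ t Vec.∷ Param.xOf′ r t p Vec.∷ Param.uOf r t p Vec.∷
            Param.vOf r t p Vec.∷ Vec.[]
      where
      r p t : Poly Carrier 3
      r = var 0F
      p = var 1F
      t = var 2F

    paramPoint : Carrier → Vector Carrier 2 → Vector Carrier 5
    paramPoint r ρ = point′ (wOf r t p) t (xOf′ r t p) (uOf r t p) (vOf r t p)
      where
      p t : Carrier
      p = ρ 0F
      t = ρ 1F

    param-value : ∀ f r ρ →
      value (r Vec.∷ ρ) (substitute rawRing id param f) ≈ value (paramPoint r ρ) f
    param-value f r ρ = trans (≡⇒≈ (eval-substitute rawRing rawRing id id (r Vec.∷ ρ) param f))
      (eval-cong commutativeRing id
        (λ { 0F → refl ; 1F → refl ; 2F → refl ; 3F → refl ; 4F → refl }) f)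

  -- The points with t (u + t v) ≠ 0 are parametrised.
  parameter-values : ∀ {w t x u v} → OnX′ w t x u v → ¬ t * (u + t * v) ≈ 0# →
    ∃[ r ] r * (t * (u + t * v) * (t * t - ι 1ℚ)) - ι 1ℚ ≈ 0# ×
           (∀ i → point′ (wOf r t (u + t * v)) t (xOf′ r t (u + t * v))
                         (uOf r t (u + t * v)) (vOf r t (u + t * v)) i ≈ point′ w t x u v i)
  parameter-values {w} {t} {x} {u} {v} P d≉0 = δ * w , parameter-inverse P h , λ where
      0F → w-recovered P h
      1F → refl
      2F → x-recovered P h
      3F → u-recovered P h
      4F → v-recovered P h
    where
    δ : Carrier
    δ = proj₁ (invertible _ d≉0)
    h : δ * (t * (u + t * v)) - ι 1ℚ ≈ 0#
    h = ≈⇒-≈0 (trans (proj₂ (invertible _ d≉0)) (sym 1#-homo))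

  open Fractions K

  private
    vanishes⇒≈0 : ∀ f → Vanishes denominator′ (substitute rawRing id param f) → f O.≈ O.0#
    vanishes⇒≈0 f van = X′-vanishing f λ {w} {t} {x} {u} {v} P d≉0 →
      let (r , re , values) = parameter-values P d≉0
          ρ = u + t * v Vec.∷ t Vec.∷ Vec.[]
      in trans (sym (trans (param-value f r ρ) (eval-cong commutativeRing id values f)))
               (vanishes van commutativeRing (id-homo commutativeRing) r ρ
                 (trans (-≈0⇒≈ re) 1#-homo))

    denominator′-≉0 : Generically 2 (λ ρ → ¬ value ρ denominator′ ≈ 0#)
    denominator′-≉0 = cofinitely-map
      (λ t (t≉0 , s≉0) → cofinitely-map (λ p p≉0 → *-≉0 (*-≉0 t≉0 p≉0) s≉0) (cofinitely-≉ 0#))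
      (cofinitely-∩ (cofinitely-≉ 0#) s-≉0)

  -- On the parametrised points, f and g are polynomials in (r, p, t).  If neither
  -- vanishes identically, then both are nonzero at a common point of X′.
  X′-isIntegralDomain : IsIntegralDomain (coordinateRing⊗ (X′ n) K)
  X′-isIntegralDomain = nontrivial , cancel
    where
    nontrivial : ¬ O.1# O.≈ O.0#
    nontrivial 1≈0 = genericPoint {λ _ _ → ⊤}
      (cofinitely-always λ _ → cofinitely-always λ _ → tt)
      λ G → 1≉0 (value-sound _ (onX′⇒solution (GenericPoint.onX G)) 1≈0)

    cancel : ∀ f g → f ⊗ g O.≈ O.0# → f O.≈ O.0# ⊎ g O.≈ O.0#
    cancel f g fg≈0
      with vanishes-or-generically-nonzero denominator′ (substitute rawRing id param f)
         | vanishes-or-generically-nonzero denominator′ (substitute rawRing id param g)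
    ... | inj₁ f-van | _          = inj₁ (vanishes⇒≈0 f f-van)
    ... | inj₂ _     | inj₁ g-van = inj₂ (vanishes⇒≈0 g g-van)
    ... | inj₂ f-gen | inj₂ g-gen = ⊥-elim (generically-∃ 2
      {λ ρ → ¬ value ρ denominator′ ≈ 0# × NonzeroAt f ρ × NonzeroAt g ρ}
      (generically-∩ 2 {λ ρ → ¬ value ρ denominator′ ≈ 0#} {λ ρ → NonzeroAt f ρ × NonzeroAt g ρ}
        denominator′-≉0 (generically-∩ 2 {NonzeroAt f} {NonzeroAt g} f-gen g-gen))
      λ (ρ , d≉0 , f≉0 , g≉0) →
        let (r , re≈1) = invertible _ d≉0
            P = onX′-parametrisation (≈⇒-≈0 (trans re≈1 (sym 1#-homo)))
        in *-≉0 (f≉0 r re≈1) (g≉0 r re≈1)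
             (trans (*-cong (param-value f r ρ) (param-value g r ρ))
                    (value-sound (paramPoint r ρ) (onX′⇒solution P) fg≈0)))
      where
      NonzeroAt : Poly Carrier 5 → Vector Carrier 2 → Set
      NonzeroAt h ρ = ∀ r → r * value ρ denominator′ ≈ 1# →
                      ¬ value (r Vec.∷ ρ) (substitute rawRing id param h) ≈ 0#

-- The maps between X, X′ and the plane

-- The affine chart of X over an extension K.
module VanishingOnX (K : Extension) (n : ℚ) where
  open ExtensionFacts K
  open Surface (extensionAlgebra K) n
  open Density K n
  open SurfacePoints K n using (onX′-negate-u; onX′-negate-v; chartDenominator-≉0)

  -- The equations of the chart with coefficients in K.
  XEquations : Vector (Poly Carrier 4) 2
  XEquations = substitute rawRing ι var ∘ Affine.equations (chart (X n))

  point : (x y u v : Carrier) → Vector Carrier 4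
  point x y u v = x Vec.∷ y Vec.∷ u Vec.∷ v Vec.∷ Vec.[]

  -- The ring of functions on the chart over K.
  module O = ℚ-Algebra (quotientAlgebra (extensionAlgebra K) XEquations)

  private
    -- The squares of u and v as polynomials in (1, x, y).
    u² v² : Poly Carrier 3
    u² = x ⊗ y ⊕ x ⊗ con (ι 1ℚ) ⊕ y ⊗ con (ι 1ℚ) ⊖ con (ι n) ⊗ (con (ι 1ℚ) ⊗ con (ι 1ℚ))
      where
      x y : Poly Carrier 3
      x = var 1F
      y = var 2F
    v² = x ⊗ y ⊖ x ⊗ con (ι 1ℚ) ⊖ y ⊗ con (ι 1ℚ) ⊕ con (ι n) ⊗ (con (ι 1ℚ) ⊗ con (ι 1ℚ))
      where
      x y : Poly Carrier 3
      x = var 1F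
      y = var 2F

    b : Vector (Poly Carrier 4) 2
    b = var 0F Vec.∷ var 1F Vec.∷ Vec.[]

    module Criterion = VanishingCriterion K XEquations (con 1#) b (var 2F) (var 3F) u² v² (con 1#)
    module N = NormalForm K XEquations (con 1# Vec.∷ b) (var 2F) (var 3F) u² v²

    variables : ∀ i → N.NF (var i)
    variables 0F = N.nf-base (var 1F)
    variables 1F = N.nf-base (var 2F)
    variables 2F = N.nf-u
    variables 3F = N.nf-v

  -- A function vanishing on the images in X of the points of X′ with
  -- t (u + t v) ≠ 0 vanishes.
  X-vanishing : ∀ g →
    (∀ {w t x u v} → OnX′ w t x u v → ¬ t * (u + t * v) ≈ 0# →
      value (point x φ⟨ w , t ⟩ u v) g ≈ 0#) →
    g O.≈ O.0#
  X-vanishing g zeros = Criterion.vanishing (O.*-identityˡ _)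
    (N.normalForm (O.sym (O.-≈0⇒≈ (relation 0F))) (O.sym (O.-≈0⇒≈ (relation 1F))) variables g)
    dense
    where
    onX′⇒onX : ∀ {w t x u v} → OnX′ w t x u v →
               ∀ i → value (point x φ⟨ w , t ⟩ u v) (XEquations i) ≈ 0#
    onX′⇒onX (onX′ e₀ e₁ e₂) 0F = e₁
    onX′⇒onX (onX′ e₀ e₁ e₂) 1F = e₂

    zero-at : ∀ {w t x u v} → OnX′ w t x u v → ¬ t ≈ 0# → ¬ c w t ≈ 0# →
              Criterion.Zero g 1# (x Vec.∷ φ⟨ w , t ⟩ Vec.∷ Vec.[]) u v
    zero-at {w} {t} {x} {u} {v} P t≉0 c≉0 = record
      { point = point x φ⟨ w , t ⟩ u v
      ; solution = onX′⇒onX P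
      ; base-at = λ { 0F → refl ; 1F → refl ; 2F → refl }
      ; u-at = refl
      ; v-at = refl
      ; zero-at = zeros P (chartDenominator-≉0 P t≉0 c≉0) }

    dense : ∀ Q → Generically 2 Q → ¬ ¬ Criterion.Zeros g Q
    dense Q gen k = genericPoint-xy {λ x y → Q (x Vec.∷ y Vec.∷ Vec.[])} gen λ G →
      let (w′ , e₀ , q) = GenericPoint.satisfies G in k (zeros-at G e₀ q)
      where
      zeros-at : (G : GenericPoint (λ x t → ∃[ w ] E₀ w t ≈ 0# × Q (x Vec.∷ φ⟨ w , t ⟩ Vec.∷ Vec.[]))) →
                 let open GenericPoint G using (x; t) in ∀ {w′} →
                 E₀ w′ t ≈ 0# → Q (x Vec.∷ φ⟨ w′ , t ⟩ Vec.∷ Vec.[]) → Criterion.Zeros g Q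
      zeros-at G {w′} e₀ q = record
        { inverse = *-identityˡ 1#
        ; u₀≉0 = u≉0
        ; v₀≉0 = v≉0
        ; satisfies = q
        ; pp = zero-at P t≉0 c≉0′
        ; mp = zero-at (onX′-negate-u P) t≉0 c≉0′
        ; pm = zero-at (onX′-negate-v P) t≉0 c≉0′
        ; mm = zero-at (onX′-negate-u (onX′-negate-v P)) t≉0 c≉0′ }
        where
        open GenericPoint G
        w≈w′ : w ≈ w′
        w≈w′ = inverse-unique (OnX′.eq₀ onX) e₀
        P : OnX′ w′ t x u v
        P = onX′-resp w≈w′ onX
        c≉0′ : ¬ c w′ t ≈ 0#
        c≉0′ c≈0 = c≉0 (trans (*-congˡ (+-congʳ (φ-cong t w≈w′))) c≈0)

-- ℚ as an extension of itself.
ℚ-extension : Extension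
ℚ-extension = record
  { commutativeRing = ℚ-ring
  ; _≈?_ = _≟ℚ_
  ; 1≉0 = λ ()
  ; invertible = λ x x≢0 → let instance _ = ℚ.≢-nonZero x≢0 in ℚ.1/ x , ℚ.*-inverseˡ x
  ; ι = id
  ; ι-homo = id-homo ℚ-ring }

-- The section, the birational map and the dominant maps, over ℚ.
module Maps (n : ℚ) where
  open ExtensionFacts ℚ-extension
  open Surface ℚ-algebra n
  open Density ℚ-extension n
  open SurfacePoints ℚ-extension n using (chartDenominator-≉0; point′; parameter-values)

  open VanishingOnX ℚ-extension n using (point; XEquations)

  X-vanishing : ∀ g →
    (∀ {w t x u v} → OnX′ w t x u v → ¬ t * (u + t * v) ≈ 0# →
      value (point x φ⟨ w , t ⟩ u v) g ≈ 0#) →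
    chart (X n) ∋ g ≈ con 0ℚ
  X-vanishing g zeros = enlarge ℚ-ring XEquations E
    (λ i → ≡.subst (λ r → chart (X n) ∋ r ≈ con 0ℚ) (≡.sym (substitute-var rawRing (E i))) (relation i))
    (VanishingOnX.X-vanishing ℚ-extension n g zeros)
    where
    E : Vector (Poly ℚ 4) 2
    E = Affine.equations (chart (X n))

  private
    onX′⇒rationalSolution : ∀ {w t x u v} → OnX′ w t x u v →
                ∀ i → value (point′ w t x u v) (Affine.equations (X′ n) i) ≈ 0#
    onX′⇒rationalSolution (onX′ e₀ e₁ e₂) 0F = e₀
    onX′⇒rationalSolution (onX′ e₀ e₁ e₂) 1F = e₁
    onX′⇒rationalSolution (onX′ e₀ e₁ e₂) 2F = e₂

  X′→X-dominant : Dominant (X′→X n)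
  X′→X-dominant g g≈0 = X-vanishing g λ {w} {t} {x} {u} {v} P _ →
    trans (sym (trans
            (≡⇒≈ (eval-substitute rawRing rawRing id id (point′ w t x u v) substituteφ g))
            (eval-cong commutativeRing id (λ { 0F → refl ; 1F → refl ; 2F → refl ; 3F → refl }) g)))
          (value-sound (point′ w t x u v) (onX′⇒rationalSolution P) g≈0)

  -- The loci t (u + t v) ≠ 0 in X′ and t p (t² - 1) ≠ 0 in the (p, t)-plane.

  d : Fn (X′ n)
  d = var 1F ⊗ (var 3F ⊕ var 1F ⊗ var 4F)

  e : Fn (chart (ℙ 2))
  e = var 1F ⊗ var 0F ⊗ (var 1F ⊗ var 1F ⊖ con 1ℚ)

  private
    -- D has coordinates (δ, w, t, x, u, v), and V has coordinates (r, p, t).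
    D V : Affine
    D = basicOpen (X′ n) d
    V = basicOpen (chart (ℙ 2)) e

    module DR = ℚ-Algebra (quotientAlgebra ℚ-algebra (Affine.equations D))
    module DS = Surface (quotientAlgebra ℚ-algebra (Affine.equations D)) n
    module VR = ℚ-Algebra (quotientAlgebra ℚ-algebra (Affine.equations V))
    module VS = Surface (quotientAlgebra ℚ-algebra (Affine.equations V)) n

    r p t : Fn V
    r = var 0F
    p = var 1F
    t = var 2F

    parametrised : VS.OnX′ (VS.wOf r t p) t (VS.xOf′ r t p) (VS.uOf r t p) (VS.vOf r t p)
    parametrised = VS.onX′-parametrisation (relation 0F)

    -- The generic point of D.
    tautological : DS.OnX′ (var 1F) (var 2F) (var 3F) (var 4F) (var 5F)
    tautological = DS.onX′ (relation 1F) (relation 2F) (relation 3F)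

    toPlane : Morphism D V
    toPlane = record
      { component = var 0F ⊗ var 1F Vec.∷ var 4F ⊕ var 2F ⊗ var 5F Vec.∷ var 2F Vec.∷ Vec.[]
      ; satisfies = λ { 0F → DS.parameter-inverse tautological (relation 0F) } }

    fromPlane : Morphism V D
    fromPlane = record
      { component = r ⊗ (t ⊗ t ⊖ con 1ℚ) Vec.∷ VS.wOf r t p Vec.∷ t Vec.∷ VS.xOf′ r t p Vec.∷
                    VS.uOf r t p Vec.∷ VS.vOf r t p Vec.∷ Vec.[]
      ; satisfies = λ where
          0F → VR.trans (VR.+-congʳ (VR.*-congˡ (VR.*-congˡ (VS.u+tv≈p {r} {t} {p} (relation 0F)))))
                 (VR.trans (VR.solve 3 (λ r t p →
                    r VR.:* (t VR.:* t VR.:- VR.κ 1ℚ) VR.:* (t VR.:* p) VR.:- VR.κ 1ℚ VR.:=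
                    r VR.:* (t VR.:* p VR.:* (t VR.:* t VR.:- VR.κ 1ℚ)) VR.:- VR.κ 1ℚ)
                    VR.refl r t p) (relation 0F))
          1F → VS.OnX′.eq₀ parametrised
          2F → VS.OnX′.eq₁ parametrised
          3F → VS.OnX′.eq₂ parametrised }

  X′-birational-plane : Birational (X′ n) (chart (ℙ 2))
  X′-birational-plane = d , e , d≉0 , e≉0 , record
    { to = toPlane
    ; from = fromPlane
    ; from∘to = λ where
        0F → DS.δ-recovered tautological (relation 0F)
        1F → DS.w-recovered tautological (relation 0F)
        2F → DR.refl
        3F → DS.x-recovered tautological (relation 0F)
        4F → DS.u-recovered tautological (relation 0F)
        5F → DS.v-recovered tautological (relation 0F)
    ; to∘from = λ where
        0F → VR.-≈0⇒≈ (VR.combine₁ r (VR.solve 3 (λ r t p →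
               r VR.:* (t VR.:* t VR.:- VR.κ 1ℚ) VR.:* (r VR.:* t VR.:* p) VR.:- r VR.:=
               r VR.:* (r VR.:* (t VR.:* p VR.:* (t VR.:* t VR.:- VR.κ 1ℚ)) VR.:- VR.κ 1ℚ))
               VR.refl r t p) (relation 0F))
        1F → VS.u+tv≈p {r} {t} {p} (relation 0F)
        2F → VR.refl }
    where
    d≉0 : ¬ (X′ n ∋ d ≈ con 0ℚ)
    d≉0 d≈0 = genericPoint {λ _ _ → ⊤} (cofinitely-always λ _ → cofinitely-always λ _ → tt)
      λ G → chartDenominator-≉0 (GenericPoint.onX G) (GenericPoint.t≉0 G) (GenericPoint.c≉0 G)
              (value-sound _ (onX′⇒rationalSolution (GenericPoint.onX G)) d≈0)

    e≉0 : ¬ (chart (ℙ 2) ∋ e ≈ con 0ℚ)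
    -- Evaluation at (p, t) = (1, 2).
    e≉0 e≈0 with value-sound (1ℚ Vec.∷ + 2 ℚ./ 1 Vec.∷ Vec.[]) (λ ()) e≈0
    ... | ()

  -- The composite of the parametrisation of X′ with X′ → X.
  plane⇢X : RationalMap (chart (ℙ 2)) (chart (X n))
  plane⇢X = record
    { denominator = e
    ; denominator≉0 = proj₁ (proj₂ (proj₂ (proj₂ X′-birational-plane)))
    ; morphism = record
      { component = VS.xOf′ r t p Vec.∷ VS.φ⟨ VS.wOf r t p , t ⟩ Vec.∷ VS.uOf r t p Vec.∷
                    VS.vOf r t p Vec.∷ Vec.[]
      ; satisfies = λ { 0F → VS.OnX′.eq₁ parametrised ; 1F → VS.OnX′.eq₂ parametrised } } }

  plane⇢X-dominant : Dominant (morphism plane⇢X)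
  plane⇢X-dominant g g≈0 = X-vanishing g λ {w} {t} {x} {u} {v} P d≉0 →
    let (r , re , values) = parameter-values P d≉0
        π = r Vec.∷ u + t * v Vec.∷ t Vec.∷ Vec.[]
    in trans (sym (trans
         (≡⇒≈ (eval-substitute rawRing rawRing id id π (component (morphism plane⇢X)) g))
         (eval-cong commutativeRing id (λ where
            0F → values 2F
            1F → φ-cong t (values 0F)
            2F → values 3F
            3F → values 4F) g)))
       (value-sound π (λ { 0F → re }) g≈0)

  -- The curve p = 1 is a section.
  section : ∃[ σ ] IsSection (π′ n) σ
  section = record
    { denominator = d₁
    ; denominator≉0 = d₁≉0
    ; morphism = record
      { component = S.wOf r₁ t₁ one Vec.∷ t₁ Vec.∷ S.xOf′ r₁ t₁ one Vec.∷ S.uOf r₁ t₁ one Vec.∷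
                    S.vOf r₁ t₁ one Vec.∷ Vec.[]
      ; satisfies = λ where
          0F → S.OnX′.eq₀ P
          1F → S.OnX′.eq₁ P
          2F → S.OnX′.eq₂ P } }
    , ≈-refl
    where
    -- The function t p (t² - 1) for p = 1.
    d₁ : Fn 𝔸¹
    d₁ = var 0F ⊗ con 1ℚ ⊗ (var 0F ⊗ var 0F ⊖ con 1ℚ)
    d₁≉0 : ¬ (𝔸¹ ∋ d₁ ≈ con 0ℚ)
    -- Evaluation at t = 2.
    d₁≉0 d₁≈0 with value-sound (+ 2 ℚ./ 1 Vec.∷ Vec.[]) (λ ()) d₁≈0
    ... | ()
    module S = Surface (quotientAlgebra ℚ-algebra (Affine.equations (basicOpen 𝔸¹ d₁))) n
    r₁ t₁ one : Fn (basicOpen 𝔸¹ d₁)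
    r₁ = var 0F
    t₁ = var 1F
    one = con 1ℚ
    P : S.OnX′ (S.wOf r₁ t₁ one) t₁ (S.xOf′ r₁ t₁ one) (S.uOf r₁ t₁ one) (S.vOf r₁ t₁ one)
    P = S.onX′-parametrisation (relation 0F)

-- Smoothness of X

-- Let P be a point of X where the combination a of the gradients of the two
-- forms vanishes, that is, a singular point of a member of the pencil of
-- quadrics.  The member with coefficients (l, m) is
--   (l + m) x y + (l - m) (x z + y z - n z²) - l u² - m v²,
-- and it is shown that P = 0 unless l = m = 0.
module Smoothness (K : Extension) (n : ℚ) (n≢0 : n ≢ 0ℚ) (n≢1 : n ≢ 1ℚ) (n≢-1 : n ≢ ℚ.- 1ℚ) where
  open ExtensionFacts K

  private
    2ℚ : ℚ
    2ℚ = + 2 ℚ./ 1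

  n-≉0 : ∀ {m} → n ≢ m → ¬ ι n - ι m ≈ 0#
  n-≉0 n≢m e = n≢m (ι-injective (-≈0⇒≈ e))

  module _ (P : Vector Carrier 5) (a : Vector Carrier 2)
    (onX : ∀ i → eval rawRing ι P (Projective.form (X n) i) ≈ 0#)
    (critical : ∀ j → a 0F * eval rawRing ι P (∂ j (Projective.form (X n) 0F)) +
                      (a 1F * eval rawRing ι P (∂ j (Projective.form (X n) 1F)) + 0#) ≈ 0#)
    where

    z x y u v l m : Carrier
    z = P 0F
    x = P 1F
    y = P 2F
    u = P 3F
    v = P 4F
    l = a 0F
    m = a 1F

    private
      -- The sum over the two forms ends with a zero.
      critical′ : ∀ j → l * eval rawRing ι P (∂ j (Projective.form (X n) 0F)) +
                        m * eval rawRing ι P (∂ j (Projective.form (X n) 1F)) ≈ 0#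
      critical′ j = trans (+-congˡ (sym (+-identityʳ _))) (critical j)

    -- The derivatives of the two forms, where dz, dx, dy, du and dv are those of
    -- the coordinates.
    module _ {k} (n z x y u v dz dx dy du dv : Polynomial k) where
      d₁ d₂ : Polynomial k
      d₁ = dx :* y :+ x :* dy :+ (dx :* z :+ x :* dz) :+ (dy :* z :+ y :* dz)
           :- (κ 0ℚ :* (z :* z) :+ n :* (dz :* z :+ z :* dz)) :- (du :* u :+ u :* du)
      d₂ = dx :* y :+ x :* dy :- (dx :* z :+ x :* dz) :- (dy :* z :+ y :* dz)
           :+ (κ 0ℚ :* (z :* z) :+ n :* (dz :* z :+ z :* dz)) :- (dv :* v :+ v :* dv)

    ∂z : (l - m) * (x + y - ι 2ℚ * ι n * z) ≈ 0#
    ∂z = trans (solve 8 (λ n z x y u v l m →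
        (l :- m) :* (x :+ y :- κ 2ℚ :* n :* z) :=
        l :* d₁ n z x y u v (κ 1ℚ) (κ 0ℚ) (κ 0ℚ) (κ 0ℚ) (κ 0ℚ) :+
        m :* d₂ n z x y u v (κ 1ℚ) (κ 0ℚ) (κ 0ℚ) (κ 0ℚ) (κ 0ℚ))
      refl (ι n) z x y u v l m) (critical′ 0F)

    ∂x : (l + m) * y + (l - m) * z ≈ 0#
    ∂x = trans (solve 8 (λ n z x y u v l m →
        (l :+ m) :* y :+ (l :- m) :* z :=
        l :* d₁ n z x y u v (κ 0ℚ) (κ 1ℚ) (κ 0ℚ) (κ 0ℚ) (κ 0ℚ) :+
        m :* d₂ n z x y u v (κ 0ℚ) (κ 1ℚ) (κ 0ℚ) (κ 0ℚ) (κ 0ℚ))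
      refl (ι n) z x y u v l m) (critical′ 1F)

    ∂y : (l + m) * x + (l - m) * z ≈ 0#
    ∂y = trans (solve 8 (λ n z x y u v l m →
        (l :+ m) :* x :+ (l :- m) :* z :=
        l :* d₁ n z x y u v (κ 0ℚ) (κ 0ℚ) (κ 1ℚ) (κ 0ℚ) (κ 0ℚ) :+
        m :* d₂ n z x y u v (κ 0ℚ) (κ 0ℚ) (κ 1ℚ) (κ 0ℚ) (κ 0ℚ))
      refl (ι n) z x y u v l m) (critical′ 2F)

    ∂u : l * u ≈ 0#
    ∂u = combine₁ (- ι ½) (solve 8 (λ n z x y u v l m →
        l :* u := (:- κ ½) :* (
        l :* d₁ n z x y u v (κ 0ℚ) (κ 0ℚ) (κ 0ℚ) (κ 1ℚ) (κ 0ℚ) :+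
        m :* d₂ n z x y u v (κ 0ℚ) (κ 0ℚ) (κ 0ℚ) (κ 1ℚ) (κ 0ℚ)))
      refl (ι n) z x y u v l m) (critical′ 3F)

    ∂v : m * v ≈ 0#
    ∂v = combine₁ (- ι ½) (solve 8 (λ n z x y u v l m →
        m :* v := (:- κ ½) :* (
        l :* d₁ n z x y u v (κ 0ℚ) (κ 0ℚ) (κ 0ℚ) (κ 0ℚ) (κ 1ℚ) :+
        m :* d₂ n z x y u v (κ 0ℚ) (κ 0ℚ) (κ 0ℚ) (κ 0ℚ) (κ 1ℚ)))
      refl (ι n) z x y u v l m) (critical′ 4F)

    AllZero : Set
    AllZero = ∀ j → P j ≈ 0#

    all-zero : z ≈ 0# → x ≈ 0# → y ≈ 0# → u ≈ 0# → v ≈ 0# → AllZero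
    all-zero z≈0 x≈0 y≈0 u≈0 v≈0 = λ where
      0F → z≈0
      1F → x≈0
      2F → y≈0
      3F → u≈0
      4F → v≈0

    -- For m = 0, x = y = - z and (n + 1) z = 0.
    first-quadric : ¬ l ≈ 0# → m ≈ 0# → AllZero
    first-quadric l≉0 m≈0 = all-zero z≈0 x≈0 y≈0 (*-zero-cancel l≉0 ∂u) (square≈0⇒≈0 v²≈0)
      where
      y+z≈0 : y + z ≈ 0#
      y+z≈0 = *-zero-cancel l≉0 (combine₂ (ι 1ℚ) (z - y) (solve 4 (λ z y l m →
        l :* (y :+ z) := κ 1ℚ :* ((l :+ m) :* y :+ (l :- m) :* z) :+ (z :- y) :* m) refl z y l m) ∂x m≈0)
      x+z≈0 : x + z ≈ 0#
      x+z≈0 = *-zero-cancel l≉0 (combine₂ (ι 1ℚ) (z - x) (solve 4 (λ z y l m →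
        l :* (y :+ z) := κ 1ℚ :* ((l :+ m) :* y :+ (l :- m) :* z) :+ (z :- y) :* m) refl z x l m) ∂y m≈0)
      x+y-2nz≈0 : x + y - ι 2ℚ * ι n * z ≈ 0#
      x+y-2nz≈0 = *-zero-cancel l≉0 (combine₂ (ι 1ℚ) (x + y - ι 2ℚ * ι n * z) (solve 3 (λ g l m →
        l :* g := κ 1ℚ :* ((l :- m) :* g) :+ g :* m) refl _ l m) ∂z m≈0)
      z≈0 : z ≈ 0#
      z≈0 = *-zero-cancel (n-≉0 n≢-1) (combine₃ (ι ½) (ι ½) (- ι ½) (solve 4 (λ n z x y →
        (n :- κ (ℚ.- 1ℚ)) :* z := κ ½ :* (x :+ z) :+ κ ½ :* (y :+ z) :+
        (:- κ ½) :* (x :+ y :- κ 2ℚ :* n :* z)) refl (ι n) z x y) x+z≈0 y+z≈0 x+y-2nz≈0)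
      x≈0 : x ≈ 0#
      x≈0 = combine₂ (ι 1ℚ) (- ι 1ℚ) (solve 2 (λ z x →
        x := κ 1ℚ :* (x :+ z) :+ (:- κ 1ℚ) :* z) refl z x) x+z≈0 z≈0
      y≈0 : y ≈ 0#
      y≈0 = combine₂ (ι 1ℚ) (- ι 1ℚ) (solve 2 (λ z x →
        x := κ 1ℚ :* (x :+ z) :+ (:- κ 1ℚ) :* z) refl z y) y+z≈0 z≈0
      v²≈0 : v * v ≈ 0#
      v²≈0 = combine₃ (- ι 1ℚ) (y - z) (ι n * z - y) (solve 5 (λ n z x y v →
        v :* v := (:- κ 1ℚ) :* (x :* y :- x :* z :- y :* z :+ n :* (z :* z) :- v :* v) :+
        (y :- z) :* x :+ (n :* z :- y) :* z) refl (ι n) z x y v) (onX 1F) x≈0 z≈0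

    -- For l = 0, x = y = z and (n - 1) z = 0.
    second-quadric : l ≈ 0# → ¬ m ≈ 0# → AllZero
    second-quadric l≈0 m≉0 = all-zero z≈0 x≈0 y≈0 (square≈0⇒≈0 u²≈0) (*-zero-cancel m≉0 ∂v)
      where
      y-z≈0 : y - z ≈ 0#
      y-z≈0 = *-zero-cancel m≉0 (combine₂ (ι 1ℚ) (- (y + z)) (solve 4 (λ z y l m →
        m :* (y :- z) := κ 1ℚ :* ((l :+ m) :* y :+ (l :- m) :* z) :+ (:- (y :+ z)) :* l) refl z y l m) ∂x l≈0)
      x-z≈0 : x - z ≈ 0#
      x-z≈0 = *-zero-cancel m≉0 (combine₂ (ι 1ℚ) (- (x + z)) (solve 4 (λ z y l m →
        m :* (y :- z) := κ 1ℚ :* ((l :+ m) :* y :+ (l :- m) :* z) :+ (:- (y :+ z)) :* l) refl z x l m) ∂y l≈0)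
      x+y-2nz≈0 : x + y - ι 2ℚ * ι n * z ≈ 0#
      x+y-2nz≈0 = *-zero-cancel m≉0 (combine₂ (- ι 1ℚ) (x + y - ι 2ℚ * ι n * z) (solve 3 (λ g l m →
        m :* g := (:- κ 1ℚ) :* ((l :- m) :* g) :+ g :* l) refl _ l m) ∂z l≈0)
      z≈0 : z ≈ 0#
      z≈0 = *-zero-cancel (n-≉0 n≢1) (combine₃ (ι ½) (ι ½) (- ι ½) (solve 4 (λ n z x y →
        (n :- κ 1ℚ) :* z := κ ½ :* (x :- z) :+ κ ½ :* (y :- z) :+
        (:- κ ½) :* (x :+ y :- κ 2ℚ :* n :* z)) refl (ι n) z x y) x-z≈0 y-z≈0 x+y-2nz≈0)
      x≈0 : x ≈ 0#
      x≈0 = trans (-≈0⇒≈ x-z≈0) z≈0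
      y≈0 : y ≈ 0#
      y≈0 = trans (-≈0⇒≈ y-z≈0) z≈0
      u²≈0 : u * u ≈ 0#
      u²≈0 = combine₃ (- ι 1ℚ) (y + z) (y - ι n * z) (solve 5 (λ n z x y u →
        u :* u := (:- κ 1ℚ) :* (x :* y :+ x :* z :+ y :* z :- n :* (z :* z) :- u :* u) :+
        (y :+ z) :* x :+ (y :- n :* z) :* z) refl (ι n) z x y u) (onX 0F) x≈0 z≈0

    -- Otherwise u = v = 0, and the sum of the equations of X gives x y = 0.
    other-quadrics : ¬ l ≈ 0# → ¬ m ≈ 0# → AllZero
    other-quadrics l≉0 m≉0 with (l - m) ≈? 0# | (l + m) ≈? 0#
    ... | β? | α? = cases β? α?
      where
      u≈0 : u ≈ 0#
      u≈0 = *-zero-cancel l≉0 ∂u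
      v≈0 : v ≈ 0#
      v≈0 = *-zero-cancel m≉0 ∂v

      xy≈0 : x * y ≈ 0#
      xy≈0 = trans (combine-forms) (trans (+-cong (combine₂ (ι ½) (ι ½) refl (onX 0F) (onX 1F))
                                                  (combine₂ (ι ½ * u) (ι ½ * v) refl u≈0 v≈0))
                                          (+-identityˡ 0#))
        where
        combine-forms : x * y ≈
          ι ½ * (x * y + x * z + y * z - ι n * (z * z) - u * u) +
          ι ½ * (x * y - x * z - y * z + ι n * (z * z) - v * v) + (ι ½ * u * u + ι ½ * v * v)
        combine-forms = solve 6 (λ n z x y u v → x :* y :=
          κ ½ :* (x :* y :+ x :* z :+ y :* z :- n :* (z :* z) :- u :* u) :+
          κ ½ :* (x :* y :- x :* z :- y :* z :+ n :* (z :* z) :- v :* v) :+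
          (κ ½ :* u :* u :+ κ ½ :* v :* v)) refl (ι n) z x y u v

      -- Here α = l + m and β = l - m.  The condition n ≠ 0 matters for β = 0 only.
      cases : Dec (l - m ≈ 0#) → Dec (l + m ≈ 0#) → AllZero
      cases (yes β≈0) (yes α≈0) = contradiction
        (combine₂ (ι ½) (ι ½) (solve 2 (λ l m → l := κ ½ :* (l :- m) :+ κ ½ :* (l :+ m)) refl l m)
          β≈0 α≈0) l≉0
      cases (yes β≈0) (no α≉0) = all-zero z≈0 x≈0 y≈0 u≈0 v≈0
        where
        y≈0 : y ≈ 0#
        y≈0 = *-zero-cancel α≉0 (combine₂ (ι 1ℚ) (- z) (solve 4 (λ z y α β →
          α :* y := κ 1ℚ :* (α :* y :+ β :* z) :+ (:- z) :* β) refl z y (l + m) (l - m)) ∂x β≈0)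
        x≈0 : x ≈ 0#
        x≈0 = *-zero-cancel α≉0 (combine₂ (ι 1ℚ) (- z) (solve 4 (λ z y α β →
          α :* y := κ 1ℚ :* (α :* y :+ β :* z) :+ (:- z) :* β) refl z x (l + m) (l - m)) ∂y β≈0)
        z≈0 : z ≈ 0#
        z≈0 = square≈0⇒≈0 (*-zero-cancel (ι-≉0 n≢0)
          (trans (solve 5 (λ n z x y u → n :* (z :* z) :=
             (:- κ 1ℚ) :* (x :* y :+ x :* z :+ y :* z :- n :* (z :* z) :- u :* u) :+ (y :+ z) :* x :+ z :* y
             :+ (:- u) :* u) refl (ι n) z x y u)
            (trans (+-cong (combine₃ (- ι 1ℚ) (y + z) z refl (onX 0F) x≈0 y≈0)
                           (combine₁ (- u) refl u≈0)) (+-identityˡ 0#))))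
      cases (no β≉0) (yes α≈0) = all-zero z≈0 x≈0 y≈0 u≈0 v≈0
        where
        z≈0 : z ≈ 0#
        z≈0 = *-zero-cancel β≉0 (combine₂ (ι 1ℚ) (- y) (solve 4 (λ z y α β →
          β :* z := κ 1ℚ :* (α :* y :+ β :* z) :+ (:- y) :* α) refl z y (l + m) (l - m)) ∂x α≈0)
        x≈0 : x ≈ 0#
        x≈0 = square≈0⇒≈0 (combine₃ x (- ι 1ℚ) (x * ι 2ℚ * ι n) (solve 4 (λ n z x y →
          x :* x := x :* (x :+ y :- κ 2ℚ :* n :* z) :+ (:- κ 1ℚ) :* (x :* y) :+ x :* κ 2ℚ :* n :* z)
          refl (ι n) z x y) (*-zero-cancel β≉0 ∂z) xy≈0 z≈0)
        y≈0 : y ≈ 0#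
        y≈0 = square≈0⇒≈0 (combine₃ y (- ι 1ℚ) (y * ι 2ℚ * ι n) (solve 4 (λ n z x y →
          y :* y := y :* (x :+ y :- κ 2ℚ :* n :* z) :+ (:- κ 1ℚ) :* (x :* y) :+ y :* κ 2ℚ :* n :* z)
          refl (ι n) z x y) (*-zero-cancel β≉0 ∂z) xy≈0 z≈0)
      cases (no β≉0) (no α≉0) = all-zero z≈0 x≈0 y≈0 u≈0 v≈0
        where
        x-y≈0 : x - y ≈ 0#
        x-y≈0 = *-zero-cancel α≉0 (combine₂ (ι 1ℚ) (- ι 1ℚ) (solve 5 (λ z x y α β →
          α :* (x :- y) := κ 1ℚ :* (α :* x :+ β :* z) :+ (:- κ 1ℚ) :* (α :* y :+ β :* z))
          refl z x y (l + m) (l - m)) ∂y ∂x)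
        x≈0 : x ≈ 0#
        x≈0 = square≈0⇒≈0 (combine₂ x (ι 1ℚ) (solve 2 (λ x y →
          x :* x := x :* (x :- y) :+ κ 1ℚ :* (x :* y)) refl x y) x-y≈0 xy≈0)
        y≈0 : y ≈ 0#
        y≈0 = trans (sym (-≈0⇒≈ x-y≈0)) x≈0
        z≈0 : z ≈ 0#
        z≈0 = *-zero-cancel β≉0 (combine₂ (ι 1ℚ) (- (l + m)) (solve 4 (λ z y α β →
          β :* z := κ 1ℚ :* (α :* y :+ β :* z) :+ (:- α) :* y) refl z y (l + m) (l - m)) ∂x y≈0)

    independent : ¬ AllZero → ∀ i → a i ≈ 0#
    independent P≉0 with l ≈? 0# | m ≈? 0#
    ... | yes l≈0 | yes m≈0 = λ { 0F → l≈0 ; 1F → m≈0 }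
    ... | no  l≉0 | yes m≈0 = contradiction (first-quadric l≉0 m≈0) P≉0
    ... | yes l≈0 | no  m≉0 = contradiction (second-quadric l≈0 m≉0) P≉0
    ... | no  l≉0 | no  m≉0 = contradiction (other-quadrics l≉0 m≉0) P≉0

X-smooth : ∀ {n} → n ≢ 0ℚ → n ≢ 1ℚ → n ≢ ℚ.- 1ℚ → Smooth (X n)
X-smooth {n} n≢0 n≢1 n≢-1 K P (j , Pj≉0) onX a critical =
  Smoothness.independent K n n≢0 n≢1 n≢-1 P a onX critical (λ P≈0 → Pj≉0 (P≈0 j))

-- X is a complete intersection

-- The quadratic extension A[√D], with elements a + b √D.
module QuadraticExtension (A : ℚ-Algebra) (D : ℚ-Algebra.Carrier A) where
  open ℚ-Algebra A

  infix  4 _≈₂_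
  infixl 6 _+₂_
  infixl 7 _*₂_

  _≈₂_ : Carrier × Carrier → Carrier × Carrier → Set
  (a , b) ≈₂ (c , d) = a ≈ c × b ≈ d

  _+₂_ _*₂_ : Carrier × Carrier → Carrier × Carrier → Carrier × Carrier
  (a , b) +₂ (c , d) = a + c , b + d
  (a , b) *₂ (c , d) = a * c + D * (b * d) , a * d + b * c

  -₂_ : Carrier × Carrier → Carrier × Carrier
  -₂ (a , b) = - a , - b

  *₂-identityˡ : ∀ p → (1# , 0#) *₂ p ≈₂ p
  *₂-identityˡ (a , b) =
    trans (+-cong (*-identityˡ a) (trans (*-congˡ (zeroˡ b)) (zeroʳ D))) (+-identityʳ a) ,
    trans (+-cong (*-identityˡ b) (zeroˡ a)) (+-identityʳ b)

  *₂-comm : ∀ p q → p *₂ q ≈₂ q *₂ p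
  *₂-comm (a , b) (c , d) =
    solve 5 (λ D a b c d → a :* c :+ D :* (b :* d) := c :* a :+ D :* (d :* b)) refl D a b c d ,
    solve 4 (λ a b c d → a :* d :+ b :* c := c :* b :+ d :* a) refl a b c d

  *₂-distribˡ : ∀ p q r → p *₂ (q +₂ r) ≈₂ p *₂ q +₂ p *₂ r
  *₂-distribˡ (a , b) (c , d) (e , f) =
    solve 7 (λ D a b c d e f → a :* (c :+ e) :+ D :* (b :* (d :+ f)) :=
      a :* c :+ D :* (b :* d) :+ (a :* e :+ D :* (b :* f))) refl D a b c d e f ,
    solve 6 (λ a b c d e f → a :* (d :+ f) :+ b :* (c :+ e) :=
      a :* d :+ b :* c :+ (a :* f :+ b :* e)) refl a b c d e f

  ≈₂-trans : ∀ {p q r} → p ≈₂ q → q ≈₂ r → p ≈₂ r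
  ≈₂-trans (e , f) (e′ , f′) = trans e e′ , trans f f′

  quadraticExtension : CommutativeRing 0ℓ 0ℓ
  quadraticExtension = record
    { Carrier = Carrier × Carrier
    ; _≈_ = _≈₂_
    ; _+_ = _+₂_
    ; _*_ = _*₂_
    ; -_ = -₂_
    ; 0# = 0# , 0#
    ; 1# = 1# , 0#
    ; isCommutativeRing = record
      { isRing = record
        { +-isAbelianGroup = record
          { isGroup = record
            { isMonoid = record
              { isSemigroup = record
                { isMagma = record
                  { isEquivalence = record
                    { refl = refl , refl
                    ; sym = λ (e , f) → sym e , sym f
                    ; trans = ≈₂-trans }
                  ; ∙-cong = λ (e , f) (e′ , f′) → +-cong e e′ , +-cong f f′ }
                ; assoc = λ _ _ _ → +-assoc _ _ _ , +-assoc _ _ _ }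
              ; identity = (λ _ → +-identityˡ _ , +-identityˡ _)
                         , (λ _ → +-identityʳ _ , +-identityʳ _) }
            ; inverse = (λ _ → -‿inverseˡ _ , -‿inverseˡ _) , (λ _ → -‿inverseʳ _ , -‿inverseʳ _)
            ; ⁻¹-cong = λ (e , f) → -‿cong e , -‿cong f }
          ; comm = λ _ _ → +-comm _ _ , +-comm _ _ }
        ; *-cong = λ (e , f) (e′ , f′) →
            +-cong (*-cong e e′) (*-congˡ (*-cong f f′)) , +-cong (*-cong e f′) (*-cong f e′)
        ; *-assoc = λ (a , b) (c , d) (e , f) →
            solve 7 (λ D a b c d e f →
              (a :* c :+ D :* (b :* d)) :* e :+ D :* ((a :* d :+ b :* c) :* f) :=
              a :* (c :* e :+ D :* (d :* f)) :+ D :* (b :* (c :* f :+ d :* e)))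
              refl D a b c d e f ,
            solve 7 (λ D a b c d e f →
              (a :* c :+ D :* (b :* d)) :* f :+ (a :* d :+ b :* c) :* e :=
              a :* (c :* f :+ d :* e) :+ b :* (c :* e :+ D :* (d :* f)))
              refl D a b c d e f
        ; *-identity = *₂-identityˡ , λ p → ≈₂-trans (*₂-comm p _) (*₂-identityˡ p)
        ; distrib = *₂-distribˡ , λ p q r → ≈₂-trans (*₂-comm _ p) (≈₂-trans (*₂-distribˡ p q r)
            (let (e , f) = *₂-comm p q ; (e′ , f′) = *₂-comm p r in +-cong e e′ , +-cong f f′))
        }
      ; *-comm = *₂-comm
      }
    }

  rational-homo : IsHom ℚ-ring quadraticExtension (λ a → ι a , 0#)
  rational-homo = record
    { isSemiringHomomorphism = record
      { isNearSemiringHomomorphism = record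
        { +-isMonoidHomomorphism = record
          { isMagmaHomomorphism = record
            { isRelHomomorphism = record { cong = λ e → ι-cong e , refl }
            ; homo = λ a b → +-homo a b , sym (+-identityʳ 0#) }
          ; ε-homo = 0#-homo , refl }
        ; *-homo = λ a b →
            trans (*-homo a b) (sym (trans (+-congˡ (trans (*-congˡ (zeroʳ 0#)) (zeroʳ D))) (+-identityʳ _))) ,
            sym (trans (+-cong (zeroʳ _) (zeroˡ _)) (+-identityʳ 0#)) }
      ; 1#-homo = 1#-homo , refl }
    ; -‿homo = λ a → -‿homo a , sym -0#≈0# }

open ExtensionFacts ℚ-extension using (_≋_; value; value-sound; zero-or-generically-≉0;
  Generically; generically-∃; generically-∩; *-≉0)

-- A nonzero polynomial is not a zero divisor.
*-cancel : ∀ {m} {E : Vector (Poly ℚ m) 0} (f g : Poly ℚ m) → ¬ f ≋ con 0ℚ →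
           _⊢_≈_ ℚ-ring E (f ⊗ g) (con 0ℚ) → g ≋ con 0ℚ
*-cancel {m} f g f≉0 fg≈0 with zero-or-generically-≉0 m f | zero-or-generically-≉0 m g
... | inj₁ f≈0   | _          = contradiction f≈0 f≉0
... | inj₂ _     | inj₁ g≈0   = g≈0
... | inj₂ f-gen | inj₂ g-gen = ⊥-elim (generically-∃ m {λ ρ → value ρ f ≢ 0ℚ × value ρ g ≢ 0ℚ}
  (generically-∩ m {λ ρ → value ρ f ≢ 0ℚ} {λ ρ → value ρ g ≢ 0ℚ} f-gen g-gen)
  λ (ρ , fρ≢0 , gρ≢0) → *-≉0 fρ≢0 gρ≢0 (value-sound ρ (λ ()) fg≈0))

-- The forms take the value -1 where u, respectively v, is 1 and the coordinates
-- z, x and y vanish.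
module _ (A : ℚ-Algebra) where
  open ℚ-Algebra A

  first-form-value : ∀ n → ι 0ℚ * ι 0ℚ + ι 0ℚ * ι 0ℚ + ι 0ℚ * ι 0ℚ - n * (ι 0ℚ * ι 0ℚ)
                           - ι 1ℚ * ι 1ℚ ≈ ι (ℚ.- 1ℚ)
  first-form-value n = solve 1 (λ n →
    κ 0ℚ :* κ 0ℚ :+ κ 0ℚ :* κ 0ℚ :+ κ 0ℚ :* κ 0ℚ :- n :* (κ 0ℚ :* κ 0ℚ) :- κ 1ℚ :* κ 1ℚ :=
    κ (ℚ.- 1ℚ)) refl n

  second-form-value : ∀ n → ι 0ℚ * ι 0ℚ - ι 0ℚ * ι 0ℚ - ι 0ℚ * ι 0ℚ + n * (ι 0ℚ * ι 0ℚ)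
                            - ι 1ℚ * ι 1ℚ ≈ ι (ℚ.- 1ℚ)
  second-form-value n = solve 1 (λ n →
    κ 0ℚ :* κ 0ℚ :- κ 0ℚ :* κ 0ℚ :- κ 0ℚ :* κ 0ℚ :+ n :* (κ 0ℚ :* κ 0ℚ) :- κ 1ℚ :* κ 1ℚ :=
    κ (ℚ.- 1ℚ)) refl n

-- The first form is q₁ = D - u², so that ℚ[z, x, y, u, v] / (q₁) is the quadratic
-- extension of ℚ[z, x, y, v] by u = √D.  The second form is an element F of the
-- base, and multiplication by F acts on the two coordinates separately.
module _ (n : ℚ) where
  private
    E : Vector (Poly ℚ 5) 1
    E = Projective.form (X n) ∘ inject {i = 1F}

    q₁ q₂ : Poly ℚ 5
    q₁ = Projective.form (X n) 0F
    q₂ = Projective.form (X n) 1F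

    A : ℚ-Algebra
    A = quotientAlgebra ℚ-algebra {n = 4} Vec.[]
    module A = ℚ-Algebra A
    module Q = ℚ-Algebra (quotientAlgebra ℚ-algebra E)

    z x y v D F : Poly ℚ 4
    z = var 0F
    x = var 1F
    y = var 2F
    v = var 3F
    D = x ⊗ y ⊕ x ⊗ z ⊕ y ⊗ z ⊖ con n ⊗ (z ⊗ z)
    F = x ⊗ y ⊖ x ⊗ z ⊖ y ⊗ z ⊕ con n ⊗ (z ⊗ z) ⊖ v ⊗ v

    open QuadraticExtension A D
    module S = CommutativeRing quadraticExtension

    -- The coordinates, with √D for u.
    coordinates : Vector (Poly ℚ 4 × Poly ℚ 4) 5
    coordinates = (z , con 0ℚ) Vec.∷ (x , con 0ℚ) Vec.∷ (y , con 0ℚ) Vec.∷ (con 0ℚ , con 1ℚ) Vec.∷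
                  (v , con 0ℚ) Vec.∷ Vec.[]

    -- The class of a polynomial modulo q₁.
    split : Poly ℚ 5 → Poly ℚ 4 × Poly ℚ 4
    split = eval S.rawRing (λ a → con a , con 0ℚ) coordinates

    open A using (κ; _:+_; _:*_; _:-_; :-_; _:=_; Polynomial)

    -- The operations of the quadratic extension on solver expressions.
    module Pairs {k} (D : Polynomial k) where
      infixl 6 _⊞_
      infixl 7 _⊠_
      _⊞_ _⊠_ : Polynomial k × Polynomial k → Polynomial k × Polynomial k → Polynomial k × Polynomial k
      (a , b) ⊞ (c , d) = a :+ c , b :+ d
      (a , b) ⊠ (c , d) = a :* c :+ D :* (b :* d) , a :* d :+ b :* c
      ⊟_ : Polynomial k × Polynomial k → Polynomial k × Polynomial k
      ⊟ (a , b) = :- a , :- b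
      rat : Polynomial k → Polynomial k × Polynomial k
      rat a = a , κ 0ℚ

    split-q₁ : split q₁ ≈₂ (con 0ℚ , con 0ℚ)
    split-q₁ = A.solve 4 (λ n z x y → proj₁ (form n z x y) := κ 0ℚ) A.refl (con n) z x y
             , A.solve 4 (λ n z x y → proj₂ (form n z x y) := κ 0ℚ) A.refl (con n) z x y
      where
      form : (n z x y : Polynomial 4) → Polynomial 4 × Polynomial 4
      form n z x y = rat x ⊠ rat y ⊞ rat x ⊠ rat z ⊞ rat y ⊠ rat z ⊞ ⊟ (rat n ⊠ (rat z ⊠ rat z)) ⊞
                     ⊟ ((κ 0ℚ , κ 1ℚ) ⊠ (κ 0ℚ , κ 1ℚ))
        where open Pairs (x :* y :+ x :* z :+ y :* z :- n :* (z :* z))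

    split-q₂ : split q₂ ≈₂ (F , con 0ℚ)
    split-q₂ = A.solve 5 (λ n z x y v → proj₁ (form n z x y v) :=
                  x :* y :- x :* z :- y :* z :+ n :* (z :* z) :- v :* v) A.refl (con n) z x y v
             , A.solve 5 (λ n z x y v → proj₂ (form n z x y v) := κ 0ℚ) A.refl (con n) z x y v
      where
      form : (n z x y v : Polynomial 5) → Polynomial 5 × Polynomial 5
      form n z x y v = rat x ⊠ rat y ⊞ ⊟ (rat x ⊠ rat z) ⊞ ⊟ (rat y ⊠ rat z) ⊞
                       rat n ⊠ (rat z ⊠ rat z) ⊞ ⊟ (rat v ⊠ rat v)
        where open Pairs (x :* y :+ x :* z :+ y :* z :- n :* (z :* z))

    split-sound : ∀ {f g} → _⊢_≈_ ℚ-ring E f g → split f ≈₂ split g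
    split-sound = eval-sound ℚ-ring quadraticExtension rational-homo coordinates λ { 0F → split-q₁ }

    embed : Poly ℚ 4 → Poly ℚ 5
    embed = substitute (CommutativeRing.rawRing ℚ-ring) id
      (var 0F Vec.∷ var 1F Vec.∷ var 2F Vec.∷ var 4F Vec.∷ Vec.[])

    join : Poly ℚ 4 × Poly ℚ 4 → Poly ℚ 5
    join (a , b) = embed a ⊕ embed b ⊗ var 3F

    u²≈D : var 3F ⊗ var 3F Q.≈ embed D
    u²≈D = Q.sym (Q.-≈0⇒≈ (relation 0F))

    rational : ∀ f → f ⊕ con 0ℚ ⊗ var 3F Q.≈ f
    rational f = Q.trans (Q.+-congˡ (Q.zeroˡ _)) (Q.+-identityʳ f)

    join-split : ∀ f → f Q.≈ join (split f)
    join-split (con a)  = Q.sym (rational _)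
    join-split (var 0F) = Q.sym (rational _)
    join-split (var 1F) = Q.sym (rational _)
    join-split (var 2F) = Q.sym (rational _)
    join-split (var 3F) = Q.sym (Q.trans (Q.+-identityˡ _) (Q.*-identityˡ _))
    join-split (var 4F) = Q.sym (rational _)
    join-split (f ⊕ g)  = Q.trans (Q.+-cong (join-split f) (join-split g))
      (Q.solve 5 (λ u a b c d → a Q.:+ b Q.:* u Q.:+ (c Q.:+ d Q.:* u) Q.:=
                                (a Q.:+ c) Q.:+ (b Q.:+ d) Q.:* u)
        Q.refl (var 3F) (embed (proj₁ (split f))) (embed (proj₂ (split f)))
        (embed (proj₁ (split g))) (embed (proj₂ (split g))))
    join-split (f ⊗ g)  = Q.trans (Q.*-cong (join-split f) (join-split g))
      (Q.trans (Q.solve 5 (λ u a b c d → (a Q.:+ b Q.:* u) Q.:* (c Q.:+ d Q.:* u) Q.:=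
                                a Q.:* c Q.:+ u Q.:* u Q.:* (b Q.:* d) Q.:+ (a Q.:* d Q.:+ b Q.:* c) Q.:* u)
        Q.refl (var 3F) (embed (proj₁ (split f))) (embed (proj₂ (split f)))
        (embed (proj₁ (split g))) (embed (proj₂ (split g))))
      (Q.+-congʳ (Q.+-congˡ (Q.*-congʳ u²≈D))))
    join-split (⊝ f)    = Q.trans (Q.-‿cong (join-split f))
      (Q.solve 3 (λ u a b → Q.:- (a Q.:+ b Q.:* u) Q.:= (Q.:- a) Q.:+ (Q.:- b) Q.:* u)
        Q.refl (var 3F) (embed (proj₁ (split f))) (embed (proj₂ (split f))))

    embed-zero : ∀ {f} → f ≋ con 0ℚ → embed f Q.≈ con 0ℚ
    embed-zero = substitute-sound ℚ-ring E (λ ())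

    -1≢0 : ¬ ℚ.- 1ℚ ≡ 0ℚ
    -1≢0 ()

    F≉0 : ¬ F ≋ con 0ℚ
    F≉0 F≈0 = -1≢0 (≡.trans (≡.sym (second-form-value ℚ-algebra n))
      (value-sound (0ℚ Vec.∷ 0ℚ Vec.∷ 0ℚ Vec.∷ 1ℚ Vec.∷ Vec.[]) (λ ()) F≈0))

    q₁≉0 : ¬ q₁ ≋ con 0ℚ
    q₁≉0 q₁≈0 = -1≢0 (≡.trans (≡.sym (first-form-value ℚ-algebra n))
      (value-sound (0ℚ Vec.∷ 0ℚ Vec.∷ 0ℚ Vec.∷ 1ℚ Vec.∷ 0ℚ Vec.∷ Vec.[]) (λ ()) q₁≈0))

  X-completeIntersection : CompleteIntersection (X n)
  X-completeIntersection 0F g q₁g≈0 =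
    enlarge ℚ-ring Vec.[] (Projective.form (X n) ∘ inject {i = 0F}) (λ ()) (*-cancel q₁ g q₁≉0 q₁g≈0)
  X-completeIntersection 1F g q₂g≈0 = Q.trans (join-split g)
    (Q.trans (Q.+-cong (embed-zero a≈0) (Q.trans (Q.*-congʳ (embed-zero b≈0)) (Q.zeroˡ _)))
             (Q.+-identityˡ _))
    where
    a b : Poly ℚ 4
    a = proj₁ (split g)
    b = proj₂ (split g)

    Fg≈0 : (F , con 0ℚ) *₂ (a , b) ≈₂ (con 0ℚ , con 0ℚ)
    Fg≈0 = S.trans (S.*-congʳ {a , b} (S.sym split-q₂)) (split-sound {q₂ ⊗ g} {con 0ℚ} q₂g≈0)

    a≈0 : a ≋ con 0ℚ
    a≈0 = *-cancel F a F≉0 (A.trans (A.sym (A.trans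
      (A.+-congˡ (A.trans (A.*-congˡ (A.zeroˡ b)) (A.zeroʳ D))) (A.+-identityʳ _))) (proj₁ Fg≈0))

    b≈0 : b ≋ con 0ℚ
    b≈0 = *-cancel F b F≉0 (A.trans (A.sym (A.trans (A.+-congˡ (A.zeroˡ a)) (A.+-identityʳ _))) (proj₂ Fg≈0))

X-isDelPezzo₄ : ∀ {n} → Smooth (X n) → IsDelPezzo₄ (X n)
X-isDelPezzo₄ {n} smooth = record
  { quadrics = λ _ → ≡.refl
  ; completeIntersection = X-completeIntersection n
  ; smooth = smooth }

mainTheorem5 : Σ[ exceptions ∈ List ℚ ] ∀ n → n ∉ exceptions →
    (Smooth (X n) × IsDelPezzo₄ (X n)) ×
    (GeometricallyIntegral (X′ n) ×
    (∃[ σ ] IsSection (π′ n) σ) ×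
    Birational (X′ n) (chart (ℙ 2)) ×
    Dominant (X′→X n) ×
    Σ[ f ∈ RationalMap (chart (ℙ 2)) (chart (X n)) ] Dominant (morphism f))
mainTheorem5 = 0ℚ ∷ 1ℚ ∷ ℚ.- 1ℚ ∷ [] , λ n n∉ →
  let smooth = X-smooth {n} (λ e → n∉ (here e)) (λ e → n∉ (there (here e)))
                            (λ e → n∉ (there (there (here e))))
      open Maps n
  in (smooth , X-isDelPezzo₄ smooth) ,
     (λ K → SurfacePoints.X′-isIntegralDomain K n) ,
     section , X′-birational-plane , X′→X-dominant , plane⇢X , plane⇢X-dominant
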